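{- Fix a genus $g\ge0$. For $n,k\ge1$ let $r(n,k)$ be the number of reduced partitions of $\{1,\ldots,n\}$ of genus $g$ with $k$ parts. Then the generating function $R(x,y)=\sum_{n,k}r(n,k)x^ny^k$ is a rational function of $x$ and $y$. Moreover, the denominator of $R(x,y)$ is a power of $1-x^2y$.
   Context: For $n\ge1$ let $\zeta_n=(1,2,\ldots,n)$; $z(\cdot)$ is the number of cycles of a permutation (fixed points included); products are composed right to left. The genus $g(\alpha)$ of a permutation $\alpha$ of $\{1,\ldots,n\}$ is the nonnegative integer defined by $n+1-2g(\alpha)=z(\alpha)+z(\alpha^{ -1}\zeta_n)$. A permutation is a partition if each of its cycles, listed beginning with its least element, is an increasing list; the parts are the cycles. A permutation $\alpha$ is reduced if neither $\alpha$ nor $\alpha^{ -1}\zeta_n$ has a fixed point. "The denominator is a power of $1-x^2y$" means that $R(x,y)=A(x,y)/(1-x^2y)^N$ for some polynomial $A$ and some integer $N\ge0$. -}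

module Defs where

open import Data.Fin.Base using (Fin; zero; suc; toℕ; fromℕ; inject₁; punchIn;
  _≤_; _<_)
open import Data.Fin.Permutation using (Permutation′; _⟨$⟩ʳ_; _∘ₚ_; id; flip; insert;
  remove; insert-punchIn; insert-remove; _≈_)
open import Data.Fin.Properties using (_≟_; _≤?_; _<?_; any?; punchIn-injective)
open import Data.Integer.Base as ℤ using (ℤ; +_; 0ℤ; 1ℤ; -1ℤ)
import Data.Integer.Properties as ℤ
open import Data.List.Base using (List; []; _∷_; [_]; map; filter; length; iterate; takeWhile;
  allFin; cartesianProductWith)
import Data.List.Membership.Setoid as Membership
open import Data.List.Membership.Propositional.Properties using (∈-allFin)
import Data.List.Membership.Setoid.Properties as Membershipₚ
open import Data.List.Relation.Unary.All using (All; all?; [])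
open import Data.List.Relation.Unary.AllPairs using ([]; _∷_)
open import Data.List.Relation.Unary.Any using (here)
open import Data.List.Relation.Unary.Linked using (Linked; linked?)
import Data.List.Relation.Unary.Unique.Setoid as Unique
import Data.List.Relation.Unary.Unique.Setoid.Properties as Uniqueₚ
import Data.List.Relation.Unary.Unique.Propositional.Properties as Unique≡ₚ
open import Data.Nat.Base as ℕ using (ℕ; zero; suc)
import Data.Nat.Properties as ℕ
open import Data.Product.Base using (_×_; _,_; ∃-syntax)
open import Level using (0ℓ)
open import Relation.Binary.Bundles using (Setoid)
open import Relation.Binary.PropositionalEquality using (_≡_; refl; sym; trans; cong; setoid)
open import Relation.Nullary using (¬_; ¬?; yes; no; contradiction)
open import Relation.Nullary.Decidable using (_×-dec_)
open import Relation.Unary using (Decidable)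

open import Algebra.Properties.Monoid.Sum ℤ.+-0-monoid using (sum⁺-syntax)

private
  variable
    n : ℕ

------------------------------------------------------------------------
-- Permutations of {1, …, n}, the element i + 1 being encoded as i : Fin n

-- ζ sends the last element to zero, and every other i to i + 1
-- (see ζ-last and ζ-step).
ζ : ∀ n → Permutation′ n
ζ zero    = id
ζ (suc n) = insert (fromℕ n) zero id

-- The product α⁻¹ζ, composed right to left: apply ζ, then α⁻¹.
_⁻¹ζ : Permutation′ n → Permutation′ n
_⁻¹ζ {n} α = ζ n ∘ₚ flip α

-- The list i, α i, α² i, … stopped just before the first return to i.  A
-- cycle has at most n elements, so n further iterates always suffice.
cycleFrom : Permutation′ n → Fin n → List (Fin n)
cycleFrom {n} α i =
  i ∷ takeWhile (λ j → ¬? (j ≟ i)) (iterate (α ⟨$⟩ʳ_) (α ⟨$⟩ʳ i) n)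

LeastInCycle : Permutation′ n → Fin n → Set
LeastInCycle α i = All (i ≤_) (cycleFrom α i)

leastInCycle? : (α : Permutation′ n) → Decidable (LeastInCycle α)
leastInCycle? α i = all? (i ≤?_) (cycleFrom α i)

-- All cycles (fixed points included), each listed once, beginning with its
-- least element.
cycles : Permutation′ n → List (List (Fin n))
cycles {n} α = map (cycleFrom α) (filter (leastInCycle? α) (allFin n))

z : Permutation′ n → ℕ
z α = length (cycles α)

HasGenus : ℕ → Permutation′ n → Set
HasGenus {n} g α = n ℕ.+ 1 ≡ z α ℕ.+ z (α ⁻¹ζ) ℕ.+ 2 ℕ.* g

IsPartition : Permutation′ n → Set
IsPartition α = All (Linked _<_) (cycles α)

HasFixedPoint : Permutation′ n → Set
HasFixedPoint α = ∃[ i ] α ⟨$⟩ʳ i ≡ i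

IsReduced : Permutation′ n → Set
IsReduced α = ¬ HasFixedPoint α × ¬ HasFixedPoint (α ⁻¹ζ)

IsReducedPartition : (g k : ℕ) → Permutation′ n → Set
IsReducedPartition g k α = IsReduced α × IsPartition α × HasGenus g α × z α ≡ k

hasFixedPoint? : Decidable (HasFixedPoint {n})
hasFixedPoint? α = any? (λ i → (α ⟨$⟩ʳ i) ≟ i)

isReducedPartition? : ∀ g k → Decidable (IsReducedPartition {n} g k)
isReducedPartition? {n} g k α =
  (¬? (hasFixedPoint? α) ×-dec ¬? (hasFixedPoint? (α ⁻¹ζ)))
  ×-dec all? (linked? _<?_) (cycles α)
  ×-dec (n ℕ.+ 1 ℕ.≟ z α ℕ.+ z (α ⁻¹ζ) ℕ.+ 2 ℕ.* g)
  ×-dec (z α ℕ.≟ k)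

-- Every permutation of Fin n exactly once up to pointwise equality
-- (see permutations-complete and permutations-unique).
permutations : ∀ n → List (Permutation′ n)
permutations zero    = [ id ]
permutations (suc n) = cartesianProductWith (insert zero) (allFin (suc n)) (permutations n)

r : (g n k : ℕ) → ℕ
r g n k = length (filter (isReducedPartition? g k) (permutations n))

------------------------------------------------------------------------
-- Formal power series in x and y over ℤ: F n k is the coefficient of xⁿyᵏ

Series : Set
Series = ℕ → ℕ → ℤ

infix  4 _≋_
infixl 7 _⊛_
infixr 8 _^ₛ_

_≋_ : Series → Series → Set
F ≋ G = ∀ n k → F n k ≡ G n k

0ₛ : Series
0ₛ _ _ = 0ℤ

1ₛ : Series
1ₛ zero zero = 1ℤ
1ₛ _    _    = 0ℤ

_⊛_ : Series → Series → Series
(F ⊛ G) n k =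
  ∑[ i ≤ n ] ∑[ j ≤ k ] (F (toℕ i) (toℕ j) ℤ.* G (n ℕ.∸ toℕ i) (k ℕ.∸ toℕ j))

_^ₛ_ : Series → ℕ → Series
F ^ₛ zero  = 1ₛ
F ^ₛ suc N = F ⊛ F ^ₛ N

1-x²y : Series
1-x²y 0 0 = 1ℤ
1-x²y 2 1 = -1ℤ
1-x²y _ _ = 0ℤ

IsPolynomial : Series → Set
IsPolynomial F = ∃[ d ] (∀ n k → d ℕ.< n ℕ.+ k → F n k ≡ 0ℤ)

-- F = P / Q, stated as F Q = P: formal power series over ℤ form an integral
-- domain, so this determines F when Q ≠ 0.
IsRational : Series → Set
IsRational F = ∃[ P ] ∃[ Q ]
  (IsPolynomial P × IsPolynomial Q × ¬ (Q ≋ 0ₛ) × F ⊛ Q ≋ P)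

DenominatorIsPowerOf : Series → Series → Set
DenominatorIsPowerOf D F = ∃[ A ] ∃[ N ] (IsPolynomial A × F ⊛ D ^ₛ N ≋ A)

-- The sum runs over n, k ≥ 1.
R : ℕ → Series
R g zero    _       = 0ℤ
R g (suc _) zero    = 0ℤ
R g (suc n) (suc k) = + r g (suc n) (suc k)

------------------------------------------------------------------------
-- Correctness of ζ and of the enumeration

private
  punchIn-last : (i : Fin n) → punchIn (fromℕ n) i ≡ inject₁ i
  punchIn-last zero    = refl
  punchIn-last (suc i) = cong suc (punchIn-last i)

  insert-at : ∀ {n} i j (π : Permutation′ n) → insert i j π ⟨$⟩ʳ i ≡ j
  insert-at i j π with i ≟ i
  ... | yes _   = refl
  ... | no  i≢i = contradiction refl i≢i

ζ-last : ∀ n → ζ (suc n) ⟨$⟩ʳ fromℕ n ≡ zero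
ζ-last n = insert-at (fromℕ n) zero id

ζ-step : (i : Fin n) → ζ (suc n) ⟨$⟩ʳ inject₁ i ≡ suc i
ζ-step {n} i = trans (cong (ζ (suc n) ⟨$⟩ʳ_) (sym (punchIn-last i)))
                     (insert-punchIn (fromℕ n) zero id i)

permutationSetoid : ℕ → Setoid 0ℓ 0ℓ
permutationSetoid n = record
  { Carrier       = Permutation′ n
  ; _≈_           = _≈_
  ; isEquivalence = record
    { refl  = λ _ → refl
    ; sym   = λ p i → sym (p i)
    ; trans = λ p q i → trans (p i) (q i)
    }
  }

private
  insert-cong : ∀ {n} {j j′ : Fin (suc n)} {π ρ : Permutation′ n} →
                j ≡ j′ → π ≈ ρ → insert zero j π ≈ insert zero j′ ρ
  insert-cong refl p zero    = refl
  insert-cong {j = j} refl p (suc i) = cong (punchIn j) (p i)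

  insert-injective : ∀ {n} {j j′ : Fin (suc n)} {π ρ : Permutation′ n} →
                     insert zero j π ≈ insert zero j′ ρ → j ≡ j′ × π ≈ ρ
  insert-injective p with refl ← p zero = refl , λ i → punchIn-injective _ _ _ (p (suc i))

permutations-complete : (α : Permutation′ n) →
  Membership._∈_ (permutationSetoid n) α (permutations n)
permutations-complete {zero}  α = here λ ()
permutations-complete {suc n} α =
  Membershipₚ.∈-resp-≈ (permutationSetoid (suc n))
    {x = insert zero (α ⟨$⟩ʳ zero) (remove zero α)} {y = α} (insert-remove zero α)
    (Membershipₚ.∈-cartesianProductWith⁺ (setoid (Fin (suc n))) (permutationSetoid n)
      (permutationSetoid (suc n))
      (λ {_} {_} {π} {ρ} p q → insert-cong {π = π} {ρ} p q)
      (∈-allFin (α ⟨$⟩ʳ zero)) (permutations-complete (remove zero α)))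

permutations-unique : ∀ n → Unique.Unique (permutationSetoid n) (permutations n)
permutations-unique zero    = [] ∷ []
permutations-unique (suc n) =
  Uniqueₚ.cartesianProductWith⁺ (setoid (Fin (suc n))) (permutationSetoid n)
    (permutationSetoid (suc n)) (insert zero)
    (λ {_} {_} {π} {ρ} p → insert-injective {π = π} {ρ} p)
    (Unique≡ₚ.allFin⁺ (suc n)) (permutations-unique n)

{-# OPTIONS --safe #-}
module Submission where

-- The map contracting one of two parallel 2-cycles (x y+1) and (x+1 y) with
-- x+1 < y to the outer one is, on the pairs (α, pair of parallel 2-cycles), a
-- bijection onto the pairs (α′, 2-cycle of α′).  It removes a 2-cycle from both
-- α and α⁻¹ζ, so it keeps reducedness, partitions and the genus.  Let K be the
-- number of 2-cycles of α and p the number of parallel pairs.  As A = n - 2K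
-- and m = K - p are kept, the numbers f(n, k) with given A and m satisfy
--   (n + 2 - A - 2m) f(n + 2, k + 1) = (n - A) f(n, k),
-- and multiplication by 1 - x²y lowers m by one in this recurrence.  The genus
-- formula bounds A by 12g and m by 30g + 1 for reduced α, because almost all
-- cycles of α and of α⁻¹ζ have length 2 and a 2-cycle of α⁻¹ζ not meeting a
-- longer cycle of α is a parallel pair, unless it contains the last point.

open import Defs
open import Algebra.Properties.CommutativeMonoid.Sum as Sum using ()
open import Data.Bool.Base using (true; false; if_then_else_)
open import Data.Empty using (⊥; ⊥-elim)
open import Data.Fin.Base using (Fin; zero; suc; toℕ; punchIn; punchOut; _≤_; _<_; inject₁; fromℕ;
  fromℕ<)
open import Data.Fin.Permutation using (Permutation′; _⟨$⟩ʳ_; _⟨$⟩ˡ_; inverseˡ; inverseʳ;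
  permutation; _≈_; flip)
open import Data.Fin.Properties as Fin using (_≟_; _<?_; punchIn-injective; punchInᵢ≢i;
  punchIn-punchOut; punchIn-mono-≤; punchIn-cancel-≤)
open import Data.Fin.Relation.Unary.Top as Top using (‵fromℕ; ‵inject₁)
open import Data.Integer.Base as ℤ using (ℤ; +_; 0ℤ; 1ℤ; -1ℤ)
import Data.Integer.Properties as ℤ
import Data.Integer.Tactic.RingSolver as ℤ
open import Data.List.Base using (List; []; _∷_; _++_; length; filter; tabulate; allFin; map;
  iterate; takeWhile; cartesianProduct)
open import Data.List.Membership.Propositional using (_∈_; find; lose)
open import Data.List.Membership.Propositional.Properties using (∈-filter⁺; ∈-filter⁻; ∈-allFin;
  ∈-cartesianProduct⁺; ∈-cartesianProduct⁻)
open import Data.List.Properties using (length-map; length-++; filter-++; filter-none)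
open import Data.List.Relation.Unary.All as All using (All; []; _∷_)
import Data.List.Relation.Unary.All.Properties as All
open import Data.List.Relation.Unary.AllPairs as AllPairs using (AllPairs; []; _∷_)
open import Data.List.Relation.Unary.Any using (Any; here; there; _─_)
open import Data.List.Relation.Unary.Linked using (Linked; [-]; _∷_)
import Data.List.Relation.Unary.Unique.Setoid.Properties as Unique
import Data.List.Relation.Unary.Unique.Propositional.Properties as Unique≡
open import Data.Nat.Base as ℕ using (ℕ; zero; suc; 2+; z≤n; s≤s; s≤s⁻¹)
import Data.Nat.Properties as ℕ
open import Data.Nat.Tactic.RingSolver using (solve-∀)
open import Data.Product.Base using (_×_; _,_; ∃-syntax; proj₁; proj₂)
open import Data.Product.Relation.Binary.Pointwise.NonDependent using (_×ₛ_)
open import Data.Sum.Base as ⊎ using (_⊎_; inj₁; inj₂)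
open import Function.Base using (_∘_; case_of_)
open import Function.Bundles using (Injection)
open import Function.Properties.Inverse using (↔⇒↣)
open import Level using (0ℓ)
open import Relation.Binary.Definitions using (Tri; tri<; tri≈; tri>)
open import Relation.Binary.PropositionalEquality
open import Relation.Nullary using (Dec; does; yes; no; ¬_; ¬?; contradiction)
open import Relation.Nullary.Decidable using (_×-dec_; _⊎-dec_; dec-true; dec-false)
open import Relation.Unary using (Pred; Decidable)

open Sum ℕ.+-0-commutativeMonoid using (sum; sum-remove; sum-permute; sum-cong-≗;
  sum-replicate-zero; ∑-distrib-+)

private
  module ℤΣ = Sum ℤ.+-0-commutativeMonoid
open ℤΣ using (sum-syntax; sum⁺-syntax)

private
  variable
    A B C : Set
    F G : Series
    n : ℕ

-- Contracting all parallel 2-cycles at once would require classes of 2-cycles as objects, together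
-- with a normal form and its expansions. Contracting one marked pair at a time needs only the
-- number of possible marks, and by the choice of A and m this number depends on n, A and m alone.
-- The resulting recurrence is the one satisfied by binomial(K - 1, m - 1), the number of ways to
-- distribute K = (n - A)/2 2-cycles over m ≥ 1 nonempty classes. Its generating function in x²y has
-- denominator (1 - x²y)^m, which explains the exponent m. For m = 0 the recurrence itself leaves
-- only finitely many nonzero terms. Permutations are compared only pointwise, by `≈`. The bijection
-- is therefore a relation between marked permutations, total and unique on both sides up to `≈`,
-- and the two lists are compared through a pigeonhole principle for relations.

⟦_⟧ : Dec A → ℕ
⟦ a? ⟧ = if does a? then 1 else 0

⟦⟧-true : (a? : Dec A) → A → ⟦ a? ⟧ ≡ 1
⟦⟧-true a? a = cong (if_then 1 else 0) (dec-true a? a)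

⟦⟧-false : (a? : Dec A) → ¬ A → ⟦ a? ⟧ ≡ 0
⟦⟧-false a? ¬a = cong (if_then 1 else 0) (dec-false a? ¬a)

⟦⟧-cong : (a? : Dec A) (b? : Dec B) → (A → B) → (B → A) → ⟦ a? ⟧ ≡ ⟦ b? ⟧
⟦⟧-cong (yes a) b? f _ = sym (⟦⟧-true b? (f a))
⟦⟧-cong (no ¬a) b? _ g = sym (⟦⟧-false b? (¬a ∘ g))

⟦⟧≤1 : (a? : Dec A) → ⟦ a? ⟧ ℕ.≤ 1
⟦⟧≤1 (yes _) = ℕ.≤-refl
⟦⟧≤1 (no _)  = z≤n

⟦⟧-⊎ : (a? : Dec A) (b? : Dec B) (c? : Dec C) →
       (A → B ⊎ C) → ⟦ a? ⟧ ℕ.≤ ⟦ b? ⟧ ℕ.+ ⟦ c? ⟧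
⟦⟧-⊎ (no _)  b? c? f = z≤n
⟦⟧-⊎ (yes a) b? c? f with f a
... | inj₁ b rewrite ⟦⟧-true b? b = s≤s z≤n
... | inj₂ c rewrite ⟦⟧-true c? c = ℕ.m≤n+m 1 ⟦ b? ⟧

⟦⟧-disjoint : (a? : Dec A) (b? : Dec B) (c? : Dec C) →
              (A → ¬ B) → (A → ¬ C) → (B → ¬ C) → ⟦ a? ⟧ ℕ.+ ⟦ b? ⟧ ℕ.+ ⟦ c? ⟧ ℕ.≤ 1
⟦⟧-disjoint (no _)  (no _)  c? _ _ _ = ⟦⟧≤1 c?
⟦⟧-disjoint (no _)  (yes b) c? _ _ h rewrite ⟦⟧-false c? (h b) = ℕ.≤-refl
⟦⟧-disjoint (yes a) b? c? f g _ rewrite ⟦⟧-false b? (f a) | ⟦⟧-false c? (g a) = ℕ.≤-refl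

-- Counting by sums of indicators

module _ {P : Pred A 0ℓ} (P? : Decidable P) where

  length-filter-tabulate : (f : Fin n → A) →
    length (filter P? (tabulate f)) ≡ sum (λ i → ⟦ P? (f i) ⟧)
  length-filter-tabulate {n = zero}  f = refl
  length-filter-tabulate {n = suc n} f with does (P? (f zero))
  ... | true  = cong suc (length-filter-tabulate (f ∘ suc))
  ... | false = length-filter-tabulate (f ∘ suc)

  length-filter-map : (f : B → A) (xs : List B) →
    length (filter P? (map f xs)) ≡ length (filter (P? ∘ f) xs)
  length-filter-map f []       = refl
  length-filter-map f (x ∷ xs) with does (P? (f x))
  ... | true  = cong suc (length-filter-map f xs)
  ... | false = length-filter-map f xs

count : {P : Pred (Fin n) 0ℓ} → Decidable P → ℕ
count P? = sum (λ i → ⟦ P? i ⟧)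

sum-mono : {f g : Fin n → ℕ} → (∀ i → f i ℕ.≤ g i) → sum f ℕ.≤ sum g
sum-mono {zero}  f≤g = z≤n
sum-mono {suc n} f≤g = ℕ.+-mono-≤ (f≤g zero) (sum-mono (f≤g ∘ suc))

sum≤n : {f : Fin n → ℕ} → (∀ i → f i ℕ.≤ 1) → sum f ℕ.≤ n
sum≤n {zero}  f≤1 = z≤n
sum≤n {suc n} f≤1 = ℕ.+-mono-≤ (f≤1 zero) (sum≤n (f≤1 ∘ suc))

module _ {P : Pred (Fin n) 0ℓ} {Q : Pred (Fin n) 0ℓ} (P? : Decidable P) (Q? : Decidable Q) where

  count-cong : (∀ i → P i → Q i) → (∀ i → Q i → P i) → count P? ≡ count Q?
  count-cong f g = sum-cong-≗ (λ i → ⟦⟧-cong (P? i) (Q? i) (f i) (g i))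

  count-mono : (∀ i → P i → Q i) → count P? ℕ.≤ count Q?
  count-mono f = sum-mono λ i → subst (⟦ P? i ⟧ ℕ.≤_) (ℕ.+-identityʳ _)
    (⟦⟧-⊎ (P? i) (Q? i) (no (λ ())) (inj₁ {B = ⊥} ∘ f i))

  module _ {S : Pred (Fin n) 0ℓ} (S? : Decidable S) where

    count-⊎ : (∀ i → P i → Q i ⊎ S i) → count P? ℕ.≤ count Q? ℕ.+ count S?
    count-⊎ f = ℕ.≤-trans (sum-mono (λ i → ⟦⟧-⊎ (P? i) (Q? i) (S? i) (f i)))
      (ℕ.≤-reflexive (∑-distrib-+ (λ i → ⟦ Q? i ⟧) (λ i → ⟦ S? i ⟧)))

    count-disjoint : (∀ i → P i → ¬ Q i) → (∀ i → P i → ¬ S i) → (∀ i → Q i → ¬ S i) →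
                     count P? ℕ.+ count Q? ℕ.+ count S? ℕ.≤ n
    count-disjoint f g h = begin
      count P? ℕ.+ count Q? ℕ.+ count S?
        ≡⟨ cong (ℕ._+ count S?) (∑-distrib-+ (λ i → ⟦ P? i ⟧) (λ i → ⟦ Q? i ⟧)) ⟨
      sum (λ i → ⟦ P? i ⟧ ℕ.+ ⟦ Q? i ⟧) ℕ.+ count S?
        ≡⟨ ∑-distrib-+ (λ i → ⟦ P? i ⟧ ℕ.+ ⟦ Q? i ⟧) (λ i → ⟦ S? i ⟧) ⟨
      sum (λ i → ⟦ P? i ⟧ ℕ.+ ⟦ Q? i ⟧ ℕ.+ ⟦ S? i ⟧)
        ≤⟨ sum≤n (λ i → ⟦⟧-disjoint (P? i) (Q? i) (S? i) (f i) (g i) (h i)) ⟩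
      n ∎
      where open ℕ.≤-Reasoning

-- Cycles

-- Replaces the list `cycleFrom`, whose length bound would obstruct inductions. Only forward
-- iterates occur; `Orbit-sym` recovers symmetry from periodicity.
data Orbit (f : A → A) (i : A) : A → Set where
  origin  : Orbit f i i
  advance  : ∀ {x} → Orbit f i x → Orbit f i (f x)

Orbit-trans : {f : A → A} {x y z : A} → Orbit f x y → Orbit f y z → Orbit f x z
Orbit-trans p origin    = p
Orbit-trans p (advance q) = advance (Orbit-trans p q)

Least : (Fin n → Fin n) → Fin n → Set
Least f i = ∀ {x} → Orbit f i x → i ≤ x

Ascending : (Fin n → Fin n) → Fin n → Set
Ascending f i = ∀ {x} → Orbit f i x → f x ≡ i ⊎ x < f x

infixr 8 _^ᶠ_

_^ᶠ_ : (A → A) → ℕ → A → A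
(f ^ᶠ zero)  x = x
(f ^ᶠ suc t) x = (f ^ᶠ t) (f x)

^ᶠ-suc : (f : A → A) (t : ℕ) (x : A) → (f ^ᶠ suc t) x ≡ f ((f ^ᶠ t) x)
^ᶠ-suc f zero    x = refl
^ᶠ-suc f (suc t) x = ^ᶠ-suc f t (f x)

Orbit-^ᶠ : (f : A → A) (t : ℕ) (x : A) → Orbit f x ((f ^ᶠ t) x)
Orbit-^ᶠ f zero    x = origin
Orbit-^ᶠ f (suc t) x = subst (Orbit f x) (sym (^ᶠ-suc f t x)) (advance (Orbit-^ᶠ f t x))

^ᶠ-∈-iterate : (f : A → A) (x : A) {s N : ℕ} → s ℕ.< N → (f ^ᶠ s) x ∈ iterate f x N
^ᶠ-∈-iterate f x {zero}  (s≤s _)   = here refl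
^ᶠ-∈-iterate f x {suc s} (s≤s s<N) = there (^ᶠ-∈-iterate f (f x) s<N)

∈-iterate⇒Orbit : (f : A → A) (x : A) (N : ℕ) {y : A} → y ∈ iterate f x N → Orbit f x y
∈-iterate⇒Orbit f x (suc N) (here refl) = origin
∈-iterate⇒Orbit f x (suc N) (there y∈)  = Orbit-trans (advance origin) (∈-iterate⇒Orbit f (f x) N y∈)

∈-takeWhile⇒∈ : {P : Pred A 0ℓ} (P? : Decidable P) (xs : List A) {x : A} →
                x ∈ takeWhile P? xs → x ∈ xs
∈-takeWhile⇒∈ P? (y ∷ xs) x∈ with does (P? y)
∈-takeWhile⇒∈ P? (y ∷ xs) (here px)  | true = here px
∈-takeWhile⇒∈ P? (y ∷ xs) (there x∈) | true = there (∈-takeWhile⇒∈ P? xs x∈)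

module _ (f : Fin n → Fin n) (i : Fin n) where

  segment : Fin n → ℕ → List (Fin n)
  segment y N = takeWhile (λ j → ¬? (j ≟ i)) (iterate f y N)

  -- The hypothesis ensures that the list stops because it meets i, not because its N iterates are
  -- used up; so the only way to leave it is through i.
  segment-closed : ∀ y N → i ∈ iterate f y N →
    (y ≡ i ⊎ y ∈ segment y N) × (∀ {x} → x ∈ segment y N → f x ≡ i ⊎ f x ∈ segment y N)
  segment-closed y (suc N) i∈ with y ≟ i
  segment-closed y (suc N) i∈          | yes y≡i = inj₁ y≡i , λ ()
  segment-closed y (suc N) (here i≡y)  | no y≢i = contradiction (sym i≡y) y≢i
  segment-closed y (suc N) (there i∈)  | no y≢i =
    let first , next = segment-closed (f y) N i∈ in
    inj₂ (here refl) ,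
    λ { (here refl) → ⊎.map₂ there first ; (there x∈) → ⊎.map₂ there (next x∈) }

  linked⇒ascending : ∀ p N → i ∈ iterate f (f p) N → Linked _<_ (p ∷ segment (f p) N) →
    ∀ {x} → x ∈ p ∷ segment (f p) N → f x ≡ i ⊎ x < f x
  linked⇒ascending p (suc N) i∈ l x∈ with f p ≟ i
  linked⇒ascending p (suc N) i∈ l           (here refl) | yes fp≡i = inj₁ fp≡i
  linked⇒ascending p (suc N) (here i≡fp) l  x∈          | no fp≢i = contradiction (sym i≡fp) fp≢i
  linked⇒ascending p (suc N) (there i∈) (p< ∷ l) (here refl) | no fp≢i = inj₂ p<
  linked⇒ascending p (suc N) (there i∈) (p< ∷ l) (there x∈)  | no fp≢i =
    linked⇒ascending (f p) N i∈ l x∈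

  ascending⇒linked : ∀ p N → (∀ {x} → x ∈ p ∷ segment (f p) N → f x ≡ i ⊎ x < f x) →
    Linked _<_ (p ∷ segment (f p) N)
  ascending⇒linked p zero    asc = [-]
  ascending⇒linked p (suc N) asc with f p ≟ i
  ... | yes _ = [-]
  ... | no fp≢i with asc (here refl)
  ...   | inj₁ fp≡i = contradiction fp≡i fp≢i
  ...   | inj₂ p<fp = p<fp ∷ ascending⇒linked (f p) N (asc ∘ there)

⟨$⟩ʳ-injective : (π : Permutation′ n) {x y : Fin n} → π ⟨$⟩ʳ x ≡ π ⟨$⟩ʳ y → x ≡ y
⟨$⟩ʳ-injective π = Injection.injective (↔⇒↣ π)

module _ (π : Permutation′ n) where

  private
    f : Fin n → Fin n
    f = π ⟨$⟩ʳ_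

    cancel : ∀ {s t} x → s ℕ.< t → t ℕ.≤ n → (f ^ᶠ s) x ≡ (f ^ᶠ t) x →
             ∃[ q ] (q ℕ.< n × (f ^ᶠ suc q) x ≡ x)
    cancel {zero}  {suc t} x _   t<n eq = t , t<n , sym eq
    cancel {suc s} {suc t} x s<t t≤n eq = cancel x (s≤s⁻¹ s<t) (ℕ.<⇒≤ t≤n)
      (⟨$⟩ʳ-injective π (trans (sym (^ᶠ-suc f s x)) (trans eq (^ᶠ-suc f t x))))

  -- Two of the n + 1 iterates with exponents 0, ..., n coincide, and injectivity strips the smaller
  -- exponent from both.
  period : ∀ x → ∃[ q ] (q ℕ.< n × (f ^ᶠ suc q) x ≡ x)
  period x with i , j , i<j , eq ← Fin.pigeonhole ℕ.≤-refl (λ (t : Fin (suc n)) → (f ^ᶠ toℕ t) x) =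
    cancel x i<j (s≤s⁻¹ (Fin.toℕ<n j)) eq

  return : ∀ x → x ∈ iterate f (f x) n
  return x with q , q<n , eq ← period x = subst (_∈ _) eq (^ᶠ-∈-iterate f (f x) q<n)

  Orbit-sym : ∀ {x y} → Orbit f x y → Orbit f y x
  Orbit-sym origin    = origin
  Orbit-sym (advance {y} p) with q , _ , eq ← period y =
    Orbit-trans (subst (Orbit f (f y)) eq (Orbit-^ᶠ f q (f y))) (Orbit-sym p)

  Orbit⇒∈cycleFrom : ∀ {i x} → Orbit f i x → x ∈ cycleFrom π i
  Orbit⇒∈cycleFrom origin    = here refl
  Orbit⇒∈cycleFrom {i} (advance p) with segment-closed f i (f i) n (return i) | Orbit⇒∈cycleFrom p
  ... | first , _ | here refl = case first of λ
    { (inj₁ eq) → here eq ; (inj₂ fi∈) → there fi∈ }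
  ... | _ , next  | there x∈  = case next x∈ of λ
    { (inj₁ eq) → here eq ; (inj₂ fx∈) → there fx∈ }

  ∈cycleFrom⇒Orbit : ∀ {i x} → x ∈ cycleFrom π i → Orbit f i x
  ∈cycleFrom⇒Orbit (here refl) = origin
  ∈cycleFrom⇒Orbit {i} (there x∈) =
    Orbit-trans (advance origin) (∈-iterate⇒Orbit f (f i) n (∈-takeWhile⇒∈ _ _ x∈))

  leastInCycle⇒Least : ∀ {i} → LeastInCycle π i → Least f i
  leastInCycle⇒Least l p = All.lookup l (Orbit⇒∈cycleFrom p)

  Least⇒leastInCycle : ∀ {i} → Least f i → LeastInCycle π i
  Least⇒leastInCycle l = All.tabulate (l ∘ ∈cycleFrom⇒Orbit)

  z≡count : z π ≡ count (leastInCycle? π)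
  z≡count = trans (length-map (cycleFrom π) (filter (leastInCycle? π) (allFin n)))
    (length-filter-tabulate (leastInCycle? π) (λ i → i))

  isPartition⇒ascending : IsPartition π → ∀ {i} → Least f i → Ascending f i
  isPartition⇒ascending part {i} l p =
    linked⇒ascending f i i n (return i)
      (All.lookup (All.map⁻ part) (∈-filter⁺ (leastInCycle? π) (∈-allFin i) (Least⇒leastInCycle l)))
      (Orbit⇒∈cycleFrom p)

  ascending⇒isPartition : (∀ {i} → Least f i → Ascending f i) → IsPartition π
  ascending⇒isPartition asc = All.map⁺ (All.tabulate λ {i} i∈ →
    ascending⇒linked f i i n λ x∈ →
      asc (leastInCycle⇒Least (proj₂ (∈-filter⁻ (leastInCycle? π) {xs = allFin n} i∈)))
        (∈cycleFrom⇒Orbit x∈))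

-- A chord is a 2-cycle, represented by its smaller point.
LowChord : Permutation′ n → Fin n → Set
LowChord π x = π ⟨$⟩ʳ (π ⟨$⟩ʳ x) ≡ x × x < π ⟨$⟩ʳ x

lowChord? : (π : Permutation′ n) → Decidable (LowChord π)
lowChord? π x = (_ ≟ _) ×-dec (_ <? _)

chords : Permutation′ n → ℕ
chords π = count (lowChord? π)

-- Adding a 2-cycle

-- `E` enumerates in increasing order the points other than b and `low`. The parameter a is the
-- position of `low` among the points left after b is removed.
module Gap {n} (a : Fin (suc n)) (b : Fin (2+ n)) where

  low : Fin (2+ n)
  low = punchIn b a

  E : Fin n → Fin (2+ n)
  E = punchIn b ∘ punchIn a

  E-injective : ∀ {x y} → E x ≡ E y → x ≡ y
  E-injective = punchIn-injective a _ _ ∘ punchIn-injective b _ _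

  E-mono-≤ : ∀ {x y} → x ≤ y → E x ≤ E y
  E-mono-≤ = punchIn-mono-≤ b _ _ ∘ punchIn-mono-≤ a _ _

  E-cancel-≤ : ∀ {x y} → E x ≤ E y → x ≤ y
  E-cancel-≤ = punchIn-cancel-≤ a _ _ ∘ punchIn-cancel-≤ b _ _

  E-mono-< : ∀ {x y} → x < y → E x < E y
  E-mono-< x<y = ℕ.≰⇒> (ℕ.<⇒≱ x<y ∘ E-cancel-≤)

  E-cancel-< : ∀ {x y} → E x < E y → x < y
  E-cancel-< x<y = ℕ.≰⇒> (ℕ.<⇒≱ x<y ∘ E-mono-≤)

  E≢high : ∀ {x} → E x ≢ b
  E≢high = punchInᵢ≢i b _

  E≢low : ∀ {x} → E x ≢ low
  E≢low = punchInᵢ≢i a _ ∘ punchIn-injective b _ _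

  data View : Fin (2+ n) → Set where
    at-high : View b
    at-low  : View low
    at-E    : ∀ x → View (E x)

  view : ∀ y → View y
  view y with b ≟ y
  ... | yes refl = at-high
  ... | no b≢y with a ≟ punchOut b≢y
  ...   | yes eq = subst View (trans (cong (punchIn b) eq) (punchIn-punchOut b≢y)) at-low
  ...   | no a≢ = subst View
    (trans (cong (punchIn b) (punchIn-punchOut a≢)) (punchIn-punchOut b≢y)) (at-E (punchOut a≢))

  module _ {P : Pred (Fin (2+ n)) 0ℓ} {P′ : Pred (Fin n) 0ℓ}
           (P? : Decidable P) (P′? : Decidable P′) where

    -- Cycles, 2-cycles and parallel pairs are all counted by a smaller point, so a new 2-cycle
    -- contributes at `low` and not at b.
    count-suc : P low → ¬ P b → (∀ x → P (E x) → P′ x) → (∀ x → P′ x → P (E x)) →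
                count P? ≡ suc (count P′?)
    count-suc plow ¬pb f g = begin
      count P?
        ≡⟨ sum-remove (λ i → ⟦ P? i ⟧) ⟩
      ⟦ P? b ⟧ ℕ.+ sum (λ i → ⟦ P? (punchIn b i) ⟧)
        ≡⟨ cong₂ ℕ._+_ (⟦⟧-false (P? b) ¬pb) (sum-remove (λ i → ⟦ P? (punchIn b i) ⟧)) ⟩
      ⟦ P? low ⟧ ℕ.+ sum (λ i → ⟦ P? (E i) ⟧)
        ≡⟨ cong₂ ℕ._+_ (⟦⟧-true (P? low) plow) (count-cong (P? ∘ E) P′? f g) ⟩
      suc (count P′?) ∎
      where open ≡-Reasoning

-- A relation instead of a construction: it applies to α, which is built as an extension, and to
-- α⁻¹ζ, which merely turns out to be one.
record Extends {n} (π : Permutation′ (2+ n)) (π′ : Permutation′ n)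
               (a : Fin (suc n)) (b : Fin (2+ n)) : Set where
  open Gap a b
  field
    E-map    : ∀ x → π ⟨$⟩ʳ E x ≡ E (π′ ⟨$⟩ʳ x)
    low↦high : π ⟨$⟩ʳ low ≡ b
    high↦low : π ⟨$⟩ʳ b ≡ low
    low<high : low < b

module ExtendsProperties {n} {π : Permutation′ (2+ n)} {π′ : Permutation′ n}
                         {a : Fin (suc n)} {b : Fin (2+ n)} (ext : Extends π π′ a b) where
  open Gap a b
  open Extends ext

  private
    f : Fin (2+ n) → Fin (2+ n)
    f = π ⟨$⟩ʳ_

    f′ : Fin n → Fin n
    f′ = π′ ⟨$⟩ʳ_

  E-map² : ∀ x → f (f (E x)) ≡ E (f′ (f′ x))
  E-map² x = trans (cong f (E-map x)) (E-map (f′ x))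

  low-map² : f (f low) ≡ low
  low-map² = trans (cong f low↦high) high↦low

  high-map² : f (f b) ≡ b
  high-map² = trans (cong f high↦low) low↦high

  Orbit-E⁺ : ∀ {i x} → Orbit f′ i x → Orbit f (E i) (E x)
  Orbit-E⁺ origin = origin
  Orbit-E⁺ (advance p) = subst (Orbit f _) (E-map _) (advance (Orbit-E⁺ p))

  Orbit-E⁻ : ∀ {i y} → Orbit f (E i) y → ∃[ x ] (y ≡ E x × Orbit f′ i x)
  Orbit-E⁻ origin = _ , refl , origin
  Orbit-E⁻ (advance p) with x , refl , q ← Orbit-E⁻ p = f′ x , E-map x , advance q

  Orbit-low : ∀ {y} → Orbit f low y → y ≡ low ⊎ y ≡ b
  Orbit-low origin = inj₁ refl
  Orbit-low (advance p) with Orbit-low p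
  ... | inj₁ refl = inj₂ low↦high
  ... | inj₂ refl = inj₁ high↦low

  Least-E⁺ : ∀ {i} → Least f′ i → Least f (E i)
  Least-E⁺ l p with x , refl , q ← Orbit-E⁻ p = E-mono-≤ (l q)

  Least-E⁻ : ∀ {i} → Least f (E i) → Least f′ i
  Least-E⁻ l p = E-cancel-≤ (l (Orbit-E⁺ p))

  Least-low : Least f low
  Least-low p with Orbit-low p
  ... | inj₁ refl = ℕ.≤-refl
  ... | inj₂ refl = ℕ.<⇒≤ low<high

  ¬Least-high : ¬ Least f b
  ¬Least-high l = ℕ.<⇒≱ low<high (subst (b ≤_) high↦low (l (advance origin)))

  z-suc : z π ≡ suc (z π′)
  z-suc = begin
    z π                          ≡⟨ z≡count π ⟩
    count (leastInCycle? π)      ≡⟨ count-suc (leastInCycle? π) (leastInCycle? π′)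
                                      (Least⇒leastInCycle π Least-low)
                                      (¬Least-high ∘ leastInCycle⇒Least π)
                                      (λ _ → Least⇒leastInCycle π′ ∘ Least-E⁻ ∘ leastInCycle⇒Least π)
                                      (λ _ → Least⇒leastInCycle π ∘ Least-E⁺ ∘ leastInCycle⇒Least π′) ⟩
    suc (count (leastInCycle? π′)) ≡⟨ cong suc (z≡count π′) ⟨
    suc (z π′)                   ∎
    where open ≡-Reasoning

  LowChord-low : LowChord π low
  LowChord-low = low-map² , subst (low <_) (sym low↦high) low<high

  ¬LowChord-high : ¬ LowChord π b
  ¬LowChord-high (_ , b<) = ℕ.<-asym low<high (subst (b <_) high↦low b<)

  LowChord-E⁺ : ∀ x → LowChord π′ x → LowChord π (E x)
  LowChord-E⁺ x (eq , x<) =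
    trans (E-map² x) (cong E eq) , subst (E x <_) (sym (E-map x)) (E-mono-< x<)

  LowChord-E⁻ : ∀ x → LowChord π (E x) → LowChord π′ x
  LowChord-E⁻ x (eq , x<) =
    E-injective (trans (sym (E-map² x)) eq) , E-cancel-< (subst (E x <_) (E-map x) x<)

  chords-suc : chords π ≡ suc (chords π′)
  chords-suc = count-suc (lowChord? π) (lowChord? π′)
    LowChord-low ¬LowChord-high LowChord-E⁻ LowChord-E⁺

  HasFixedPoint⁺ : HasFixedPoint π′ → HasFixedPoint π
  HasFixedPoint⁺ (x , eq) = E x , trans (E-map x) (cong E eq)

  HasFixedPoint⁻ : HasFixedPoint π → HasFixedPoint π′
  HasFixedPoint⁻ (y , eq) with view y
  ... | at-high = contradiction (trans (sym high↦low) eq) (Fin.<⇒≢ low<high)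
  ... | at-low = contradiction (trans (sym eq) low↦high) (Fin.<⇒≢ low<high)
  ... | at-E x = x , E-injective (trans (sym (E-map x)) eq)

  IsPartition⁺ : IsPartition π′ → IsPartition π
  IsPartition⁺ part = ascending⇒isPartition π λ {i} l {x} p → ascend i l p
    where
    ascend : ∀ i → Least f i → Ascending f i
    ascend i l p with view i
    ... | at-high = ⊥-elim (¬Least-high l)
    ... | at-low with Orbit-low p
    ...   | inj₁ refl = inj₂ (subst (low <_) (sym low↦high) low<high)
    ...   | inj₂ refl = inj₁ high↦low
    ascend i l p | at-E i′ with x , refl , q ← Orbit-E⁻ p =
      ⊎.map (λ eq → trans (E-map x) (cong E eq))
              (λ x< → subst (E x <_) (sym (E-map x)) (E-mono-< x<))
              (isPartition⇒ascending π′ part (Least-E⁻ l) q)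

  IsPartition⁻ : IsPartition π → IsPartition π′
  IsPartition⁻ part = ascending⇒isPartition π′ λ l {x} p →
    ⊎.map (λ eq → E-injective (trans (sym (E-map x)) eq))
            (λ x< → E-cancel-< (subst (E x <_) (E-map x) x<))
            (isPartition⇒ascending π part (Least-E⁺ l) (Orbit-E⁺ p))

module GapExtension {n} (a : Fin (suc n)) (b : Fin (2+ n)) where
  open Gap a b

  private
    extendView : (Fin n → Fin n) → ∀ {y} → View y → Fin (2+ n)
    extendView f at-high  = low
    extendView f at-low   = b
    extendView f (at-E x) = E (f x)

    -- Stated for an arbitrary view with an equation, because `view b` does not reduce for a
    -- variable b.
    extendView-high : ∀ f {y} (w : View y) → y ≡ b → extendView f w ≡ low
    extendView-high f at-high  _  = refl
    extendView-high f at-low   eq = contradiction eq (punchInᵢ≢i b a)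
    extendView-high f (at-E x) eq = contradiction eq E≢high

    extendView-low : ∀ f {y} (w : View y) → y ≡ low → extendView f w ≡ b
    extendView-low f at-high  eq = contradiction (sym eq) (punchInᵢ≢i b a)
    extendView-low f at-low   _  = refl
    extendView-low f (at-E x) eq = contradiction eq E≢low

    extendView-E : ∀ f {x y} (w : View y) → y ≡ E x → extendView f w ≡ E (f x)
    extendView-E f at-high  eq = contradiction (sym eq) E≢high
    extendView-E f at-low   eq = contradiction (sym eq) E≢low
    extendView-E f (at-E x) eq = cong (E ∘ f) (E-injective eq)

  extend : (Fin n → Fin n) → Fin (2+ n) → Fin (2+ n)
  extend f y = extendView f (view y)

  extend-high : ∀ f → extend f b ≡ low
  extend-high f = extendView-high f (view b) refl

  extend-low : ∀ f → extend f low ≡ b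
  extend-low f = extendView-low f (view low) refl

  extend-E : ∀ f x → extend f (E x) ≡ E (f x)
  extend-E f x = extendView-E f (view (E x)) refl

  extend-inverse : ∀ f g → (∀ x → f (g x) ≡ x) → ∀ y → extend f (extend g y) ≡ y
  extend-inverse f g inv y with view y
  ... | at-high  = extend-low f
  ... | at-low   = extend-high f
  ... | at-E x   = trans (extend-E f (g x)) (cong E (inv x))

  extension : low < b → (π′ : Permutation′ n) → ∃[ π ] Extends π π′ a b
  extension low<b π′ =
    permutation (extend (π′ ⟨$⟩ʳ_)) (extend (π′ ⟨$⟩ˡ_))
      (extend-inverse _ _ (λ _ → inverseʳ π′)) (extend-inverse _ _ (λ _ → inverseˡ π′)) ,
    record
      { E-map    = extend-E _
      ; low↦high = extend-low _
      ; high↦low = extend-high _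
      ; low<high = low<b
      }

  E-preimage : ∀ y → y ≢ b → y ≢ low → ∃[ x ] E x ≡ y
  E-preimage y y≢b y≢low with view y
  ... | at-high = contradiction refl y≢b
  ... | at-low  = contradiction refl y≢low
  ... | at-E x  = x , refl

  restriction : (π : Permutation′ (2+ n)) → low < b → π ⟨$⟩ʳ low ≡ b → π ⟨$⟩ʳ b ≡ low →
                ∃[ π′ ] Extends π π′ a b
  restriction π low<b low↦b b↦low =
    permutation (proj₁ ∘ to) (proj₁ ∘ from) to-from from-to ,
    record { E-map = sym ∘ proj₂ ∘ to ; low↦high = low↦b ; high↦low = b↦low ; low<high = low<b }
    where
    b↤low : π ⟨$⟩ˡ b ≡ low
    b↤low = trans (cong (π ⟨$⟩ˡ_) (sym low↦b)) (inverseˡ π)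

    low↤b : π ⟨$⟩ˡ low ≡ b
    low↤b = trans (cong (π ⟨$⟩ˡ_) (sym b↦low)) (inverseˡ π)

    to : ∀ x → ∃[ x′ ] E x′ ≡ π ⟨$⟩ʳ E x
    to x = E-preimage _
      (λ eq → E≢low (trans (sym (inverseˡ π)) (trans (cong (π ⟨$⟩ˡ_) eq) b↤low)))
      (λ eq → E≢high (trans (sym (inverseˡ π)) (trans (cong (π ⟨$⟩ˡ_) eq) low↤b)))

    from : ∀ x → ∃[ x′ ] E x′ ≡ π ⟨$⟩ˡ E x
    from x = E-preimage _
      (λ eq → E≢low (trans (sym (inverseʳ π)) (trans (cong (π ⟨$⟩ʳ_) eq) b↦low)))
      (λ eq → E≢high (trans (sym (inverseʳ π)) (trans (cong (π ⟨$⟩ʳ_) eq) low↦b)))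

    to-from : ∀ x → proj₁ (to (proj₁ (from x))) ≡ x
    to-from x = E-injective (trans (proj₂ (to _))
      (trans (cong (π ⟨$⟩ʳ_) (proj₂ (from x))) (inverseʳ π)))

    from-to : ∀ x → proj₁ (from (proj₁ (to x))) ≡ x
    from-to x = E-injective (trans (proj₂ (from _))
      (trans (cong (π ⟨$⟩ˡ_) (proj₂ (to x))) (inverseˡ π)))

  extension-unique : ∀ {π₁ π₂ π₁′ π₂′} → Extends π₁ π₁′ a b → Extends π₂ π₂′ a b →
                     π₁′ ≈ π₂′ → π₁ ≈ π₂
  extension-unique e₁ e₂ eq y with view y
  ... | at-high = trans (Extends.high↦low e₁) (sym (Extends.high↦low e₂))
  ... | at-low  = trans (Extends.low↦high e₁) (sym (Extends.low↦high e₂))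
  ... | at-E x  = trans (Extends.E-map e₁ x) (trans (cong E (eq x)) (sym (Extends.E-map e₂ x)))

  restriction-unique : ∀ {π₁ π₂ π₁′ π₂′} → Extends π₁ π₁′ a b → Extends π₂ π₂′ a b →
                       π₁ ≈ π₂ → π₁′ ≈ π₂′
  restriction-unique e₁ e₂ eq x =
    E-injective (trans (sym (Extends.E-map e₁ x)) (trans (eq _) (Extends.E-map e₂ x)))

-- Positions of points after an insertion

punchIn-inject₁ : (a : Fin (suc n)) (i : Fin n) →
                  punchIn (inject₁ a) (inject₁ i) ≡ inject₁ (punchIn a i)
punchIn-inject₁ zero    i       = refl
punchIn-inject₁ (suc a) zero    = refl
punchIn-inject₁ (suc a) (suc i) = cong suc (punchIn-inject₁ a i)

punchIn-fromℕ : (a : Fin (suc n)) → punchIn (inject₁ a) (fromℕ n) ≡ fromℕ (suc n)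
punchIn-fromℕ         zero    = refl
punchIn-fromℕ {suc n} (suc a) = cong suc (punchIn-fromℕ a)

punchIn-≤ : {i : Fin (suc n)} {j : Fin n} → toℕ i ℕ.≤ toℕ j → punchIn i j ≡ suc j
punchIn-≤ {i = zero}              _         = refl
punchIn-≤ {i = suc i} {suc j}     (s≤s i≤j) = cong suc (punchIn-≤ i≤j)

punchIn-> : {i : Fin (suc n)} {j : Fin n} → toℕ j ℕ.< toℕ i → punchIn i j ≡ inject₁ j
punchIn-> {i = suc i} {zero}  _         = refl
punchIn-> {i = suc i} {suc j} (s≤s j<i) = cong suc (punchIn-> j<i)

punchIn-inject₁≡punchIn-suc : {a i : Fin n} → i ≢ a → punchIn (inject₁ a) i ≡ punchIn (suc a) i
punchIn-inject₁≡punchIn-suc {a = zero}  {zero}  i≢a = contradiction refl i≢a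
punchIn-inject₁≡punchIn-suc {a = zero}  {suc i} i≢a = refl
punchIn-inject₁≡punchIn-suc {a = suc a} {zero}  i≢a = refl
punchIn-inject₁≡punchIn-suc {a = suc a} {suc i} i≢a =
  cong suc (punchIn-inject₁≡punchIn-suc (i≢a ∘ cong suc))

-- The omitted position `inject₁ a` is not the last one, so the last point remains last.
punchIn-last⇒ : (a i : Fin n) → suc (toℕ (punchIn (inject₁ a) i)) ≡ suc n → suc (toℕ i) ≡ n
punchIn-last⇒ zero    i       eq = ℕ.suc-injective eq
punchIn-last⇒ (suc a) (suc i) eq = cong suc (punchIn-last⇒ a i (ℕ.suc-injective eq))

punchIn-last⇐ : (a i : Fin n) → suc (toℕ i) ≡ n → suc (toℕ (punchIn (inject₁ a) i)) ≡ suc n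
punchIn-last⇐ zero    i       eq = cong suc eq
punchIn-last⇐ (suc a) (suc i) eq = cong suc (punchIn-last⇐ a i (ℕ.suc-injective eq))
punchIn-last⇐ (suc ()) zero   refl

-- Parallel chords

-- With y = α⁻¹ζ x, the 2-cycles (x y+1) and (x+1 y) of α; the pair may not wrap
-- around the end, so that the contraction keeps the first point.
Parallel : Permutation′ n → Fin n → Set
Parallel {n} α x =
  LowChord (α ⁻¹ζ) x ×
  suc (toℕ y) ≢ n ×
  α ⟨$⟩ʳ (α ⟨$⟩ʳ x) ≡ x ×
  α ⟨$⟩ʳ (α ⟨$⟩ʳ y) ≡ y
  where y = α ⁻¹ζ ⟨$⟩ʳ x

parallel? : (α : Permutation′ n) → Decidable (Parallel α)
parallel? α x = lowChord? (α ⁻¹ζ) x ×-dec ¬? (_ ℕ.≟ _) ×-dec (_ ≟ _) ×-dec (_ ≟ _)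

parallels : Permutation′ n → ℕ
parallels α = count (parallel? α)

⁻¹ζ-inverse : (α : Permutation′ n) (x : Fin n) → α ⟨$⟩ʳ (α ⁻¹ζ ⟨$⟩ʳ x) ≡ ζ n ⟨$⟩ʳ x
⁻¹ζ-inverse α x = inverseʳ α

⁻¹ζ-≡ : (α : Permutation′ n) (x y : Fin n) → α ⟨$⟩ʳ y ≡ ζ n ⟨$⟩ʳ x → α ⁻¹ζ ⟨$⟩ʳ x ≡ y
⁻¹ζ-≡ α x y eq = trans (cong (α ⟨$⟩ˡ_) (sym eq)) (inverseˡ α)

module _ {n} {c d : Fin (suc n)} (c<d : c < d) where

  private
    v : Fin (3 ℕ.+ n)
    v = suc (inject₁ d)

    -- By values, `e` omits c + 1 and d + 1, the 2-cycle added to α′; `h` omits c and d + 1, the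
    -- 2-cycle this adds to α′⁻¹ζ; and `k` omits c + 1 and d + 2, the images of c and d + 1 under ζ.
    module e = Gap (suc c) v
    module h = Gap (inject₁ c) v
    module k = Gap (suc c) (suc (suc d))

    c≢d : c ≢ d
    c≢d refl = ℕ.<-irrefl refl c<d

  inner-low : e.low ≡ suc (inject₁ c)
  inner-low = cong suc (punchIn-> (subst (toℕ c ℕ.<_) (sym (Fin.toℕ-inject₁ d)) c<d))

  outer-low : h.low ≡ inject₁ (inject₁ c)
  outer-low = punchIn-> (subst₂ ℕ._<_ (sym (Fin.toℕ-inject₁ c)) (cong suc (sym (Fin.toℕ-inject₁ d)))
                                (ℕ.m≤n⇒m≤1+n c<d))

  e-c : e.E c ≡ h.low
  e-c = cong (punchIn v) (punchIn-> (ℕ.n<1+n (toℕ c)))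

  e-d : e.E d ≡ suc (suc d)
  e-d = trans (cong (punchIn v) (punchIn-≤ c<d))
    (cong suc (punchIn-≤ (ℕ.≤-reflexive (Fin.toℕ-inject₁ d))))

  h-c : h.E c ≡ e.low
  h-c = cong (punchIn v) (punchIn-≤ (ℕ.≤-reflexive (Fin.toℕ-inject₁ c)))

  h≡e : ∀ {x} → x ≢ c → h.E x ≡ e.E x
  h≡e x≢c = cong (punchIn v) (punchIn-inject₁≡punchIn-suc x≢c)

  k-d : k.E d ≡ v
  k-d = trans (cong (punchIn (suc (suc d))) (punchIn-≤ c<d)) (punchIn-> (ℕ.n<1+n (suc (toℕ d))))

  k≡e : ∀ {x} → x ≢ d → k.E x ≡ e.E x
  k≡e {x} x≢d = sym (punchIn-inject₁≡punchIn-suc λ eq →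
    x≢d (punchIn-injective (suc c) x d (trans eq (sym (punchIn-≤ c<d)))))

  -- ζ shifts the two points omitted by `h` to those omitted by `k`. The wrap-around survives
  -- because `h` does not omit the last point and `k` does not omit the first.
  ζ-h : ∀ x → ζ (3 ℕ.+ n) ⟨$⟩ʳ h.E x ≡ k.E (ζ (suc n) ⟨$⟩ʳ x)
  ζ-h x with Top.view x
  ... | ‵fromℕ = begin
    ζ (3 ℕ.+ n) ⟨$⟩ʳ h.E (fromℕ n)
      ≡⟨ cong (λ y → ζ (3 ℕ.+ n) ⟨$⟩ʳ punchIn v y) (punchIn-fromℕ c) ⟩
    ζ (3 ℕ.+ n) ⟨$⟩ʳ punchIn v (fromℕ (suc n))
      ≡⟨ cong (ζ (3 ℕ.+ n) ⟨$⟩ʳ_) (punchIn-fromℕ (suc d)) ⟩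
    ζ (3 ℕ.+ n) ⟨$⟩ʳ fromℕ (2+ n)
      ≡⟨ ζ-last (2+ n) ⟩
    k.E zero
      ≡⟨ cong k.E (ζ-last n) ⟨
    k.E (ζ (suc n) ⟨$⟩ʳ fromℕ n) ∎
    where open ≡-Reasoning
  ... | ‵inject₁ i = begin
    ζ (3 ℕ.+ n) ⟨$⟩ʳ h.E (inject₁ i)
      ≡⟨ cong (λ y → ζ (3 ℕ.+ n) ⟨$⟩ʳ punchIn v y) (punchIn-inject₁ c i) ⟩
    ζ (3 ℕ.+ n) ⟨$⟩ʳ punchIn v (inject₁ (punchIn c i))
      ≡⟨ cong (ζ (3 ℕ.+ n) ⟨$⟩ʳ_) (punchIn-inject₁ (suc d) (punchIn c i)) ⟩
    ζ (3 ℕ.+ n) ⟨$⟩ʳ inject₁ (punchIn (suc d) (punchIn c i))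
      ≡⟨ ζ-step (punchIn (suc d) (punchIn c i)) ⟩
    k.E (suc i)
      ≡⟨ cong k.E (ζ-step i) ⟨
    k.E (ζ (suc n) ⟨$⟩ʳ inject₁ i) ∎
    where open ≡-Reasoning

  ζ-outer-low : ζ (3 ℕ.+ n) ⟨$⟩ʳ h.low ≡ e.low
  ζ-outer-low = trans (cong (ζ (3 ℕ.+ n) ⟨$⟩ʳ_) outer-low) (trans (ζ-step (inject₁ c)) (sym inner-low))

  ζ-high : ζ (3 ℕ.+ n) ⟨$⟩ʳ v ≡ e.E d
  ζ-high = trans (ζ-step (suc d)) (sym e-d)

  inner-low<high : e.low < v
  inner-low<high = subst (_< v) (sym inner-low)
    (s≤s (subst₂ ℕ._<_ (sym (Fin.toℕ-inject₁ c)) (sym (Fin.toℕ-inject₁ d)) c<d))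

  outer-low<high : h.low < v
  outer-low<high = subst (_< v) (sym outer-low)
    (subst₂ ℕ._<_ (sym (trans (Fin.toℕ-inject₁ _) (Fin.toℕ-inject₁ c)))
       (cong suc (sym (Fin.toℕ-inject₁ d))) (ℕ.m≤n⇒m≤1+n c<d))

  module _ {α : Permutation′ (3 ℕ.+ n)} {α′ : Permutation′ (suc n)}
           (c↦d : α′ ⟨$⟩ʳ c ≡ d) (d↦c : α′ ⟨$⟩ʳ d ≡ c) (ext : Extends α α′ (suc c) v) where

    private
      module α = Extends ext
      module αp = ExtendsProperties ext

    -- `h` differs from `e` only at c, and `k` differs from `e` only at d = α′ c. At c the claim is
    -- that the inner 2-cycle sends c + 1 to d + 1.
    α-h : ∀ x → α ⟨$⟩ʳ h.E x ≡ k.E (α′ ⟨$⟩ʳ x)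
    α-h x with x ≟ c
    ... | yes refl = trans (cong (α ⟨$⟩ʳ_) h-c)
      (trans α.low↦high (trans (sym k-d) (cong k.E (sym c↦d))))
    ... | no x≢c = trans (cong (α ⟨$⟩ʳ_) (h≡e x≢c))
      (trans (α.E-map x) (sym (k≡e λ eq → x≢c (⟨$⟩ʳ-injective α′ (trans eq (sym c↦d))))))

    -- By `ζ-h` and `α-h`, α⁻¹ζ ∘ h = α⁻¹ ∘ k ∘ ζ = h ∘ α′⁻¹ζ. The new 2-cycle joins c and d + 1,
    -- since α sends d + 1 to c + 1 = ζ c and c to d + 2 = ζ (d + 1).
    ⁻¹ζ-extends : Extends (α ⁻¹ζ) (α′ ⁻¹ζ) (inject₁ c) v
    ⁻¹ζ-extends = record
      { E-map    = λ x → ⁻¹ζ-≡ α (h.E x) (h.E (α′ ⁻¹ζ ⟨$⟩ʳ x))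
          (trans (α-h _) (trans (cong k.E (⁻¹ζ-inverse α′ x)) (sym (ζ-h x))))
      ; low↦high = ⁻¹ζ-≡ α h.low v (trans α.high↦low (sym ζ-outer-low))
      ; high↦low = ⁻¹ζ-≡ α v h.low
          (trans (cong (α ⟨$⟩ʳ_) (sym e-c)) (trans (α.E-map c) (trans (cong e.E c↦d) (sym ζ-high))))
      ; low<high = outer-low<high
      }

    private
      module β = Extends ⁻¹ζ-extends
      module βp = ExtendsProperties ⁻¹ζ-extends

    c-map² : α′ ⟨$⟩ʳ (α′ ⟨$⟩ʳ c) ≡ c
    c-map² = trans (cong (α′ ⟨$⟩ʳ_) c↦d) d↦c

    h-map²⁺ : ∀ {x} → α′ ⟨$⟩ʳ (α′ ⟨$⟩ʳ x) ≡ x → α ⟨$⟩ʳ (α ⟨$⟩ʳ h.E x) ≡ h.E x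
    h-map²⁺ {x} eq with x ≟ c
    ... | yes refl = trans (cong (λ y → α ⟨$⟩ʳ (α ⟨$⟩ʳ y)) h-c) (trans αp.low-map² (sym h-c))
    ... | no x≢c rewrite h≡e x≢c = trans (αp.E-map² x) (cong e.E eq)

    h-map²⁻ : ∀ {x} → α ⟨$⟩ʳ (α ⟨$⟩ʳ h.E x) ≡ h.E x → α′ ⟨$⟩ʳ (α′ ⟨$⟩ʳ x) ≡ x
    h-map²⁻ {x} eq with x ≟ c
    ... | yes refl = c-map²
    ... | no x≢c rewrite h≡e x≢c = e.E-injective (trans (sym (αp.E-map² x)) eq)

    outer-low-map² : α ⟨$⟩ʳ (α ⟨$⟩ʳ h.low) ≡ h.low
    outer-low-map² rewrite sym e-c = trans (αp.E-map² c) (cong e.E c-map²)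

    Parallel-low : Parallel α h.low
    Parallel-low rewrite β.low↦high =
      (β.high↦low , outer-low<high) ,
      -- d + 1 is not the last point because the outer 2-cycle ends at d + 2.
      (λ eq → ℕ.<⇒≢ (Fin.toℕ<n d)
        (trans (sym (Fin.toℕ-inject₁ d)) (ℕ.suc-injective (ℕ.suc-injective eq)))) ,
      outer-low-map² , αp.high-map²

    Parallel-E⁺ : ∀ x → Parallel α′ x → Parallel α (h.E x)
    Parallel-E⁺ x (chord , nonlast , x² , y²) =
      βp.LowChord-E⁺ x chord ,
      (λ eq → nonlast (punchIn-last⇒ c _ (punchIn-last⇒ (suc d) _
        (subst (λ y → suc (toℕ y) ≡ 3 ℕ.+ n) (β.E-map x) eq)))) ,
      h-map²⁺ x² ,
      subst (λ y → α ⟨$⟩ʳ (α ⟨$⟩ʳ y) ≡ y) (sym (β.E-map x)) (h-map²⁺ y²)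

    Parallel-E⁻ : ∀ x → Parallel α (h.E x) → Parallel α′ x
    Parallel-E⁻ x (chord , nonlast , x² , y²) =
      βp.LowChord-E⁻ x chord ,
      (λ eq → nonlast (subst (λ y → suc (toℕ y) ≡ 3 ℕ.+ n) (sym (β.E-map x))
        (punchIn-last⇐ (suc d) _ (punchIn-last⇐ c _ eq)))) ,
      h-map²⁻ x² ,
      h-map²⁻ (subst (λ y → α ⟨$⟩ʳ (α ⟨$⟩ʳ y) ≡ y) (β.E-map x) y²)

    parallels-suc : parallels α ≡ suc (parallels α′)
    parallels-suc = h.count-suc (parallel? α) (parallel? α′)
      Parallel-low (βp.¬LowChord-high ∘ proj₁) Parallel-E⁻ Parallel-E⁺

-- α is α′ with a 2-cycle (c+1 d+1) inserted inside the 2-cycle (c d); x is the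
-- image of c.
record Doubling {n} (α : Permutation′ (3 ℕ.+ n)) (x : Fin (3 ℕ.+ n))
                (α′ : Permutation′ (suc n)) (c : Fin (suc n)) : Set where
  constructor doubling
  field
    d     : Fin (suc n)
    c<d   : c < d
    c↦d   : α′ ⟨$⟩ʳ c ≡ d
    d↦c   : α′ ⟨$⟩ʳ d ≡ c
    x≡c   : x ≡ inject₁ (inject₁ c)
    ext   : Extends α α′ (suc c) (suc (inject₁ d))

doubling-exists : (α′ : Permutation′ (suc n)) (c : Fin (suc n)) → LowChord α′ c →
                  ∃[ α ] ∃[ x ] Doubling α x α′ c
doubling-exists α′ c (c² , c<d) =
  let α , ext = GapExtension.extension (suc c) (suc (inject₁ (α′ ⟨$⟩ʳ c))) (inner-low<high c<d) α′
  in α , _ , doubling _ c<d refl c² refl ext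

doubling-Parallel : {α : Permutation′ (3 ℕ.+ n)} {x : Fin (3 ℕ.+ n)}
                    {α′ : Permutation′ (suc n)} {c : Fin (suc n)} →
                    Doubling α x α′ c → Parallel α x
doubling-Parallel {α = α} (doubling d c<d c↦d d↦c refl ext) =
  subst (Parallel α) (outer-low c<d) (Parallel-low c<d c↦d d↦c ext)

doubling-LowChord : {α : Permutation′ (3 ℕ.+ n)} {x : Fin (3 ℕ.+ n)}
                    {α′ : Permutation′ (suc n)} {c : Fin (suc n)} →
                    Doubling α x α′ c → LowChord α′ c
doubling-LowChord (doubling d c<d refl d↦c refl ext) = d↦c , c<d

-- With y = α⁻¹ζ x, the inner 2-cycle (x+1 y) is the one removed. It would degenerate to a fixed
-- point of α if y = x + 1.
contraction-exists : (α : Permutation′ (3 ℕ.+ n)) (x : Fin (3 ℕ.+ n)) → ¬ HasFixedPoint α →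
                     Parallel α x → ∃[ α′ ] ∃[ c ] Doubling α x α′ c
contraction-exists {n} α x ¬fixed ((β² , x<βx) , nonlast , x² , y²) =
  contract (α ⁻¹ζ ⟨$⟩ʳ x) x<βx nonlast y² (⁻¹ζ-inverse α x)
    (trans (cong (α ⟨$⟩ʳ_) (sym β²)) (⁻¹ζ-inverse α (α ⁻¹ζ ⟨$⟩ʳ x)))
  where
  contract : ∀ y → x < y → suc (toℕ y) ≢ 3 ℕ.+ n → α ⟨$⟩ʳ (α ⟨$⟩ʳ y) ≡ y →
             α ⟨$⟩ʳ y ≡ ζ (3 ℕ.+ n) ⟨$⟩ʳ x → α ⟨$⟩ʳ x ≡ ζ (3 ℕ.+ n) ⟨$⟩ʳ y →
             ∃[ α′ ] ∃[ c ] Doubling α x α′ c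
  -- Here the larger point is d + 1; it is not last, so d lies in the range of α′.
  contract (suc y) x<y nonlast y² αy αx with Top.view y
  ... | ‵fromℕ     = contradiction (cong 2+ (Fin.toℕ-fromℕ (suc n))) nonlast
  ... | ‵inject₁ d = α′ , c , doubling d c<d c↦d d↦c x≡c ext
    where
    v : Fin (3 ℕ.+ n)
    v = suc (inject₁ d)

    x≤d : toℕ x ℕ.≤ toℕ d
    x≤d = subst (toℕ x ℕ.≤_) (Fin.toℕ-inject₁ d) (s≤s⁻¹ x<y)

    x<n : toℕ x ℕ.< suc n
    x<n = ℕ.≤-<-trans x≤d (Fin.toℕ<n d)

    c : Fin (suc n)
    c = fromℕ< x<n

    x≡c : x ≡ inject₁ (inject₁ c)
    x≡c = Fin.toℕ-injective (sym (trans (Fin.toℕ-inject₁ (inject₁ c))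
      (trans (Fin.toℕ-inject₁ c) (Fin.toℕ-fromℕ< x<n))))

    ζx : ζ (3 ℕ.+ n) ⟨$⟩ʳ x ≡ suc (inject₁ c)
    ζx = trans (cong (ζ (3 ℕ.+ n) ⟨$⟩ʳ_) x≡c) (ζ-step (inject₁ c))

    c≢d : c ≢ d
    c≢d c≡d = ¬fixed (v , trans αy (trans ζx (cong (suc ∘ inject₁) c≡d)))

    c<d : c < d
    c<d = Fin.≤∧≢⇒< (subst (ℕ._≤ toℕ d) (sym (Fin.toℕ-fromℕ< x<n)) x≤d) c≢d

    open Gap (suc c) v

    high↦low : α ⟨$⟩ʳ v ≡ low
    high↦low = trans αy (trans ζx (sym (inner-low c<d)))

    restricted : ∃[ α′ ] Extends α α′ (suc c) v
    restricted = GapExtension.restriction (suc c) v α (inner-low<high c<d)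
      (trans (cong (α ⟨$⟩ʳ_) (sym high↦low)) y²) high↦low

    α′ : Permutation′ (suc n)
    α′ = proj₁ restricted

    ext : Extends α α′ (suc c) v
    ext = proj₂ restricted

    E-c : E c ≡ x
    E-c = trans (e-c c<d) (trans (outer-low c<d) (sym x≡c))

    x↦ : α ⟨$⟩ʳ x ≡ E d
    x↦ = trans αx (trans (ζ-step (suc d)) (sym (e-d c<d)))

    c↦d : α′ ⟨$⟩ʳ c ≡ d
    c↦d = E-injective (trans (sym (Extends.E-map ext c)) (trans (cong (α ⟨$⟩ʳ_) E-c) x↦))

    d↦c : α′ ⟨$⟩ʳ d ≡ c
    d↦c = E-injective (trans (sym (Extends.E-map ext d))
      (trans (cong (α ⟨$⟩ʳ_) (sym x↦)) (trans x² (sym E-c))))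

high-unique : ∀ {α₁ α₂ : Permutation′ (3 ℕ.+ n)} {α₁′ α₂′ c d₁ d₂} → c < d₁ → c < d₂ →
              Extends α₁ α₁′ (suc c) (suc (inject₁ d₁)) →
              Extends α₂ α₂′ (suc c) (suc (inject₁ d₂)) →
              α₁ ≈ α₂ → suc (inject₁ d₁) ≡ suc (inject₁ d₂)
high-unique {α₁ = α₁} c<d₁ c<d₂ e₁ e₂ eq = trans (sym (Extends.low↦high e₁))
  (trans (cong (α₁ ⟨$⟩ʳ_) (trans (inner-low c<d₁) (sym (inner-low c<d₂))))
    (trans (eq _) (Extends.low↦high e₂)))

module _ {α₁ α₂ : Permutation′ (3 ℕ.+ n)} {x₁ x₂ : Fin (3 ℕ.+ n)}
         {α₁′ α₂′ : Permutation′ (suc n)} {c₁ c₂ : Fin (suc n)} where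

  -- This and `contraction-unique` supply the disjointness that `length-≤` asks for in the two
  -- directions.
  doubling-unique : Doubling α₁ x₁ α₁′ c₁ → Doubling α₂ x₂ α₂′ c₂ →
                    α₁′ ≈ α₂′ × c₁ ≡ c₂ → α₁ ≈ α₂ × x₁ ≡ x₂
  doubling-unique (doubling d₁ _ c↦d₁ _ refl e₁) (doubling d₂ _ c↦d₂ _ refl e₂) (eq , refl)
    with refl ← trans (sym c↦d₁) (trans (eq c₁) c↦d₂) =
    GapExtension.extension-unique (suc c₁) (suc (inject₁ d₁)) {π₁ = α₁} {π₂ = α₂} {α₁′} {α₂′}
      e₁ e₂ eq , refl

  contraction-unique : Doubling α₁ x₁ α₁′ c₁ → Doubling α₂ x₂ α₂′ c₂ →
                       α₁ ≈ α₂ × x₁ ≡ x₂ → α₁′ ≈ α₂′ × c₁ ≡ c₂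
  contraction-unique (doubling d₁ c<d₁ _ _ refl e₁) (doubling d₂ c<d₂ _ _ x≡c₂ e₂) (eq , refl)
    with refl ← Fin.inject₁-injective (Fin.inject₁-injective x≡c₂)
    with refl ← Fin.inject₁-injective (Fin.suc-injective (high-unique c<d₁ c<d₂ e₁ e₂ eq)) =
    GapExtension.restriction-unique (suc c₁) (suc (inject₁ d₁)) {π₁ = α₁} {π₂ = α₂} {α₁′} {α₂′}
      e₁ e₂ eq , refl

module _ {α : Permutation′ (3 ℕ.+ n)} {x : Fin (3 ℕ.+ n)}
         {α′ : Permutation′ (suc n)} {c : Fin (suc n)} (D : Doubling α x α′ c) where

  private
    open Doubling D
    ext-β = ⁻¹ζ-extends c<d c↦d d↦c ext
    module αp = ExtendsProperties ext
    module βp = ExtendsProperties ext-β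

  doubling-chords : chords α ≡ suc (chords α′)
  doubling-chords = αp.chords-suc

  doubling-parallels : parallels α ≡ suc (parallels α′)
  doubling-parallels = parallels-suc c<d c↦d d↦c ext

  private
    sum-z : ∀ g → z α ℕ.+ z (α ⁻¹ζ) ℕ.+ 2 ℕ.* g ≡ 2+ (z α′ ℕ.+ z (α′ ⁻¹ζ) ℕ.+ 2 ℕ.* g)
    sum-z g = cong (ℕ._+ 2 ℕ.* g)
      (trans (cong₂ ℕ._+_ αp.z-suc βp.z-suc) (cong suc (ℕ.+-suc (z α′) (z (α′ ⁻¹ζ)))))

  doubling-reduced⁺ : ∀ {g k} → IsReducedPartition g k α′ → IsReducedPartition g (suc k) α
  doubling-reduced⁺ {g} ((¬fα , ¬fβ) , part , genus , parts) =
    (¬fα ∘ αp.HasFixedPoint⁻ , ¬fβ ∘ βp.HasFixedPoint⁻) ,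
    αp.IsPartition⁺ part ,
    genus⁺ ,
    trans αp.z-suc (cong suc parts)
    where
    genus⁺ : HasGenus g α
    genus⁺ = trans (cong 2+ genus) (sym (sum-z g))

  doubling-reduced⁻ : ∀ {g k} → IsReducedPartition g (suc k) α → IsReducedPartition g k α′
  doubling-reduced⁻ {g} ((¬fα , ¬fβ) , part , genus , parts) =
    (¬fα ∘ αp.HasFixedPoint⁺ , ¬fβ ∘ βp.HasFixedPoint⁺) ,
    αp.IsPartition⁻ part ,
    genus⁻ genus ,
    ℕ.suc-injective (trans (sym αp.z-suc) parts)
    where
    genus⁻ : HasGenus g α → HasGenus g α′
    genus⁻ eq = ℕ.suc-injective (ℕ.suc-injective (trans eq (sum-z g)))

count-permute : {P : Pred (Fin n) 0ℓ} (P? : Decidable P) (π : Permutation′ n) →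
                count (P? ∘ (π ⟨$⟩ʳ_)) ≡ count P?
count-permute P? π = sym (sum-permute (λ i → ⟦ P? i ⟧) π)

count≡0 : {P : Pred (Fin n) 0ℓ} (P? : Decidable P) → (∀ i → ¬ P i) → count P? ≡ 0
count≡0 {n} P? ¬P = trans (sum-cong-≗ (λ i → ⟦⟧-false (P? i) (¬P i))) (sum-replicate-zero n)

count≤1 : {P : Pred (Fin n) 0ℓ} (P? : Decidable P) → (∀ {i j} → P i → P j → i ≡ j) → count P? ℕ.≤ 1
count≤1 {zero}  P? unique = z≤n
count≤1 {suc n} P? unique with P? zero
... | yes p = ℕ.≤-reflexive (cong suc (count≡0 (P? ∘ suc) λ _ q → case unique p q of λ ()))
... | no _  = count≤1 (P? ∘ suc) λ p q → Fin.suc-injective (unique p q)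

-- Bounds on the numbers of cycles and chords

Bent : Permutation′ n → Fin n → Set
Bent π x = ¬ π ⟨$⟩ʳ (π ⟨$⟩ʳ x) ≡ x

bent? : (π : Permutation′ n) → Decidable (Bent π)
bent? π x = ¬? (_ ≟ _)

bends : Permutation′ n → ℕ
bends π = count (bent? π)

module _ (π : Permutation′ n) where

  private
    f f⁻¹ : Fin n → Fin n
    f = π ⟨$⟩ʳ_
    f⁻¹ = π ⟨$⟩ˡ_

    f-f⁻¹ : ∀ {x} → f (f⁻¹ x) ≡ x
    f-f⁻¹ = inverseʳ π

  Least-unique : ∀ {i j} → Least f i → Least f j → Orbit f i j → i ≡ j
  Least-unique l l′ p = Fin.≤-antisym (l p) (l′ (Orbit-sym π p))

  z≤size : z π ℕ.≤ n
  z≤size = subst (ℕ._≤ n) (sym (z≡count π)) (sum≤n (λ i → ⟦⟧≤1 (leastInCycle? π i)))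

  -- The bent points, the lower ends and the upper ends of the 2-cycles are pairwise disjoint; the
  -- upper ends are the points i with a lower end at f⁻¹ i.
  bends+chords : bends π ℕ.+ chords π ℕ.+ chords π ℕ.≤ n
  bends+chords = subst (λ k → bends π ℕ.+ chords π ℕ.+ k ℕ.≤ n) (count-permute (lowChord? π) (flip π))
    (count-disjoint (bent? π) (lowChord? π) (lowChord? π ∘ f⁻¹)
      (λ _ bent (flat , _) → bent flat)
      (λ i bent (flat , _) → bent (flat⁻¹ flat))
      (λ i (flat , i<) (flat′ , <i) → ℕ.<-asym
        (subst (i <_) (trans (cong f (sym f-f⁻¹)) flat′) i<)
        (subst (f⁻¹ i <_) f-f⁻¹ <i)))
    where
    flat⁻¹ : ∀ {i} → f (f (f⁻¹ i)) ≡ f⁻¹ i → f (f i) ≡ i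
    flat⁻¹ eq = trans (cong f (trans (cong f (sym f-f⁻¹)) eq)) f-f⁻¹

  chords+chords : chords π ℕ.+ chords π ℕ.≤ n
  chords+chords = ℕ.≤-trans (ℕ.+-monoˡ-≤ (chords π) (ℕ.m≤n+m (chords π) (bends π))) bends+chords

  -- Counts the first two points of every cycle, and the third point of every
  -- cycle that is not a 2-cycle.
  3z≤n+chords : ¬ HasFixedPoint π → 3 ℕ.* z π ℕ.≤ n ℕ.+ chords π
  3z≤n+chords ¬fixed rewrite z≡count π = begin
    3 ℕ.* l                          ≡⟨ 3*≡ l ⟩
    l ℕ.+ l ℕ.+ l                    ≤⟨ ℕ.+-monoʳ-≤ (l ℕ.+ l) (count-⊎ least? long? (lowChord? π) split) ⟩
    l ℕ.+ l ℕ.+ (count long? ℕ.+ chords π) ≡⟨ ℕ.+-assoc (l ℕ.+ l) _ _ ⟨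
    l ℕ.+ l ℕ.+ count long? ℕ.+ chords π   ≡⟨ cong₂ (λ s t → l ℕ.+ s ℕ.+ t ℕ.+ chords π)
                                               (count-permute least? (flip π))
                                               (trans (count-permute (long? ∘ f⁻¹) (flip π))
                                                      (count-permute long? (flip π))) ⟨
    l ℕ.+ count (least? ∘ f⁻¹) ℕ.+ count (long? ∘ f⁻¹ ∘ f⁻¹) ℕ.+ chords π
      ≤⟨ ℕ.+-monoˡ-≤ (chords π) (count-disjoint least? (least? ∘ f⁻¹) (long? ∘ f⁻¹ ∘ f⁻¹)
           disjoint₁₂
           -- A point that is both first and third in its cycle has f⁻¹ (f⁻¹ i) = i, which a bent
           -- point excludes.
           (λ i p (q , bent) → bent (subst (λ y → f (f y) ≡ y) (sym (disjoint₁₃ i p q)) (disjoint₁₃′ i p q)))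
           (λ i p (q , _) → disjoint₁₂ (f⁻¹ i) p q)) ⟩
    n ℕ.+ chords π ∎
    where
    open ℕ.≤-Reasoning

    least? = leastInCycle? π

    long? : Decidable (λ i → LeastInCycle π i × Bent π i)
    long? i = least? i ×-dec bent? π i

    l = count least?

    3*≡ : ∀ m → 3 ℕ.* m ≡ m ℕ.+ m ℕ.+ m
    3*≡ = solve-∀

    split : ∀ i → LeastInCycle π i → (LeastInCycle π i × Bent π i) ⊎ LowChord π i
    split i p with f (f i) ≟ i
    ... | no bent  = inj₁ (p , bent)
    ... | yes flat = inj₂ (flat ,
      Fin.≤∧≢⇒< (leastInCycle⇒Least π p (advance origin)) (λ eq → ¬fixed (i , sym eq)))

    disjoint₁₂ : ∀ i → LeastInCycle π i → ¬ LeastInCycle π (f⁻¹ i)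
    disjoint₁₂ i p q = ¬fixed (f⁻¹ i , trans f-f⁻¹ (sym (Least-unique
      (leastInCycle⇒Least π q) (leastInCycle⇒Least π p)
      (subst (Orbit f (f⁻¹ i)) f-f⁻¹ (advance origin)))))

    disjoint₁₃ : ∀ i → LeastInCycle π i → LeastInCycle π (f⁻¹ (f⁻¹ i)) → f⁻¹ (f⁻¹ i) ≡ i
    disjoint₁₃ i p q = Least-unique (leastInCycle⇒Least π q) (leastInCycle⇒Least π p)
      (subst (Orbit f (f⁻¹ (f⁻¹ i))) (trans (cong f f-f⁻¹) f-f⁻¹) (advance (advance origin)))

    disjoint₁₃′ : ∀ i → LeastInCycle π i → LeastInCycle π (f⁻¹ (f⁻¹ i)) → f (f i) ≡ i
    disjoint₁₃′ i p q = trans (cong (f ∘ f) (sym (disjoint₁₃ i p q))) (trans (cong f f-f⁻¹) f-f⁻¹)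

ζ-nonlast : (y : Fin n) → ¬ suc (toℕ y) ≡ n → toℕ (ζ n ⟨$⟩ʳ y) ≡ suc (toℕ y)
ζ-nonlast {suc n} y nonlast with Top.view y
... | ‵fromℕ     = contradiction (cong suc (Fin.toℕ-fromℕ n)) nonlast
... | ‵inject₁ i = trans (cong toℕ (ζ-step i)) (cong suc (sym (Fin.toℕ-inject₁ i)))

module _ (α : Permutation′ n) where

  private
    β : Permutation′ n
    β = α ⁻¹ζ

  -- α x = ζ (α⁻¹ζ x) is the point just above α⁻¹ζ x, which already exceeds x. It follows that the
  -- subtraction in `classes` is not truncated.
  Parallel⇒LowChord : ∀ x → Parallel α x → LowChord α x
  Parallel⇒LowChord x ((β² , x<βx) , nonlast , x² , _) = x² , (begin-strict
    toℕ x                         <⟨ x<βx ⟩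
    toℕ (β ⟨$⟩ʳ x)                <⟨ ℕ.n<1+n _ ⟩
    suc (toℕ (β ⟨$⟩ʳ x))          ≡⟨ ζ-nonlast _ nonlast ⟨
    toℕ (ζ n ⟨$⟩ʳ (β ⟨$⟩ʳ x))     ≡⟨ cong toℕ (⁻¹ζ-inverse α (β ⟨$⟩ʳ x)) ⟨
    toℕ (α ⟨$⟩ʳ (β ⟨$⟩ʳ (β ⟨$⟩ʳ x))) ≡⟨ cong (λ y → toℕ (α ⟨$⟩ʳ y)) β² ⟩
    toℕ (α ⟨$⟩ʳ x)                ∎)
    where open ℕ.≤-Reasoning

  parallels≤chords : parallels α ℕ.≤ chords α
  parallels≤chords = count-mono (parallel? α) (lowChord? α) Parallel⇒LowChord

  -- The 1 pays for the 2-cycle through the last point; `bends α` occurs once for each of the two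
  -- ends of a 2-cycle of α⁻¹ζ.
  chords-⁻¹ζ : chords β ℕ.≤ parallels α ℕ.+ (1 ℕ.+ (bends α ℕ.+ bends α))
  chords-⁻¹ζ = begin
    chords β
      ≤⟨ count-⊎ (lowChord? β) (parallel? α) other? split ⟩
    parallels α ℕ.+ count other?
      ≤⟨ ℕ.+-monoʳ-≤ (parallels α) (count-⊎ other? last? bent²? (λ _ o → o)) ⟩
    parallels α ℕ.+ (count last? ℕ.+ count bent²?)
      ≤⟨ ℕ.+-monoʳ-≤ (parallels α) (ℕ.+-mono-≤ last≤1
           (count-⊎ bent²? (bent? α) (bent? α ∘ (β ⟨$⟩ʳ_)) (λ _ o → o))) ⟩
    parallels α ℕ.+ (1 ℕ.+ (bends α ℕ.+ count (bent? α ∘ (β ⟨$⟩ʳ_))))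
      ≡⟨ cong (λ t → parallels α ℕ.+ (1 ℕ.+ (bends α ℕ.+ t))) (count-permute (bent? α) β) ⟩
    parallels α ℕ.+ (1 ℕ.+ (bends α ℕ.+ bends α)) ∎
    where
    open ℕ.≤-Reasoning

    Last : Fin n → Set
    Last x = suc (toℕ x) ≡ n

    last? : Decidable (λ x → Last (β ⟨$⟩ʳ x))
    last? x = _ ℕ.≟ _

    bent²? : Decidable (λ x → Bent α x ⊎ Bent α (β ⟨$⟩ʳ x))
    bent²? x = bent? α x ⊎-dec bent? α (β ⟨$⟩ʳ x)

    other? : Decidable (λ x → Last (β ⟨$⟩ʳ x) ⊎ (Bent α x ⊎ Bent α (β ⟨$⟩ʳ x)))
    other? x = last? x ⊎-dec bent²? x

    last≤1 : count last? ℕ.≤ 1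
    last≤1 = count≤1 last? λ p q → ⟨$⟩ʳ-injective β
      (Fin.toℕ-injective (ℕ.suc-injective (trans p (sym q))))

    split : ∀ x → LowChord β x →
            Parallel α x ⊎ (Last (β ⟨$⟩ʳ x) ⊎ (Bent α x ⊎ Bent α (β ⟨$⟩ʳ x)))
    split x c with suc (toℕ (β ⟨$⟩ʳ x)) ℕ.≟ n
    ... | yes last = inj₂ (inj₁ last)
    ... | no nonlast with α ⟨$⟩ʳ (α ⟨$⟩ʳ x) ≟ x
    ...   | no bent = inj₂ (inj₂ (inj₁ bent))
    ...   | yes x² with α ⟨$⟩ʳ (α ⟨$⟩ʳ (β ⟨$⟩ʳ x)) ≟ (β ⟨$⟩ʳ x)
    ...     | no bent = inj₂ (inj₂ (inj₂ bent))
    ...     | yes y²  = inj₁ (c , nonlast , x² , y²)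

-- Phrased for numbers, so that the estimate also applies with α and α⁻¹ζ exchanged. The cycle
-- bounds enter three times the genus formula; a surplus of 3 is given away.
module _ {n zα zβ kα kβ g : ℕ} (α-bound : 3 ℕ.* zα ℕ.≤ n ℕ.+ kα) (β-bound : 3 ℕ.* zβ ℕ.≤ n ℕ.+ kβ)
         (genus : n ℕ.+ 1 ≡ zα ℕ.+ zβ ℕ.+ 2 ℕ.* g) where

  private
    sum-bound : n ℕ.≤ kα ℕ.+ kβ ℕ.+ 6 ℕ.* g
    sum-bound = ℕ.≤-trans (ℕ.m≤m+n n 3) (ℕ.+-cancelˡ-≤ (n ℕ.+ n) _ _ (begin
      n ℕ.+ n ℕ.+ (n ℕ.+ 3)                    ≡⟨ identity₁ n ⟩
      3 ℕ.* (n ℕ.+ 1)                          ≡⟨ cong (3 ℕ.*_) genus ⟩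
      3 ℕ.* (zα ℕ.+ zβ ℕ.+ 2 ℕ.* g)            ≡⟨ identity₂ zα zβ g ⟩
      3 ℕ.* zα ℕ.+ 3 ℕ.* zβ ℕ.+ 6 ℕ.* g        ≤⟨ ℕ.+-monoˡ-≤ (6 ℕ.* g) (ℕ.+-mono-≤ α-bound β-bound) ⟩
      n ℕ.+ kα ℕ.+ (n ℕ.+ kβ) ℕ.+ 6 ℕ.* g      ≡⟨ identity₃ n kα kβ g ⟩
      n ℕ.+ n ℕ.+ (kα ℕ.+ kβ ℕ.+ 6 ℕ.* g)      ∎))
      where
      open ℕ.≤-Reasoning
      identity₁ : ∀ n → n ℕ.+ n ℕ.+ (n ℕ.+ 3) ≡ 3 ℕ.* (n ℕ.+ 1)
      identity₁ = solve-∀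
      identity₂ : ∀ a b g → 3 ℕ.* (a ℕ.+ b ℕ.+ 2 ℕ.* g) ≡ 3 ℕ.* a ℕ.+ 3 ℕ.* b ℕ.+ 6 ℕ.* g
      identity₂ = solve-∀
      identity₃ : ∀ n a b g → n ℕ.+ a ℕ.+ (n ℕ.+ b) ℕ.+ 6 ℕ.* g ≡ n ℕ.+ n ℕ.+ (a ℕ.+ b ℕ.+ 6 ℕ.* g)
      identity₃ = solve-∀

  n≤2chords : kβ ℕ.+ kβ ℕ.≤ n → n ℕ.≤ 2 ℕ.* kα ℕ.+ 12 ℕ.* g
  n≤2chords 2kβ≤n = ℕ.+-cancelˡ-≤ n _ _ (begin
    n ℕ.+ n                                       ≤⟨ ℕ.+-mono-≤ sum-bound sum-bound ⟩
    kα ℕ.+ kβ ℕ.+ 6 ℕ.* g ℕ.+ (kα ℕ.+ kβ ℕ.+ 6 ℕ.* g) ≡⟨ identity kα kβ g ⟩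
    kβ ℕ.+ kβ ℕ.+ (2 ℕ.* kα ℕ.+ 12 ℕ.* g)         ≤⟨ ℕ.+-monoˡ-≤ (2 ℕ.* kα ℕ.+ 12 ℕ.* g) 2kβ≤n ⟩
    n ℕ.+ (2 ℕ.* kα ℕ.+ 12 ℕ.* g)                 ∎)
    where
    open ℕ.≤-Reasoning
    identity : ∀ a b g → a ℕ.+ b ℕ.+ 6 ℕ.* g ℕ.+ (a ℕ.+ b ℕ.+ 6 ℕ.* g) ≡
                         b ℕ.+ b ℕ.+ (2 ℕ.* a ℕ.+ 12 ℕ.* g)
    identity = solve-∀

module _ {g k : ℕ} {α : Permutation′ n} (red : IsReducedPartition g k α) where

  private
    β : Permutation′ n
    β = α ⁻¹ζ

    α-bound : 3 ℕ.* z α ℕ.≤ n ℕ.+ chords α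
    α-bound = 3z≤n+chords α (proj₁ (proj₁ red))

    β-bound : 3 ℕ.* z β ℕ.≤ n ℕ.+ chords β
    β-bound = 3z≤n+chords β (proj₂ (proj₁ red))

    genus : n ℕ.+ 1 ≡ z α ℕ.+ z β ℕ.+ 2 ℕ.* g
    genus = proj₁ (proj₂ (proj₂ red))

  reduced-n≤ : n ℕ.≤ 2 ℕ.* chords α ℕ.+ 12 ℕ.* g
  reduced-n≤ = n≤2chords {zα = z α} {z β} {chords α} {chords β} {g} α-bound β-bound genus (chords+chords β)

  private
    β-n≤ : n ℕ.≤ 2 ℕ.* chords β ℕ.+ 12 ℕ.* g
    β-n≤ = n≤2chords {zα = z β} {z α} {chords β} {chords α} {g} β-bound α-bound
      (trans genus (cong (ℕ._+ 2 ℕ.* g) (ℕ.+-comm (z α) (z β)))) (chords+chords α)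

    bends≤ : bends α ℕ.≤ 12 ℕ.* g
    bends≤ = ℕ.+-cancelˡ-≤ (2 ℕ.* chords α) _ _ (begin
      2 ℕ.* chords α ℕ.+ bends α             ≡⟨ identity (chords α) (bends α) ⟩
      bends α ℕ.+ chords α ℕ.+ chords α      ≤⟨ bends+chords α ⟩
      n                                      ≤⟨ reduced-n≤ ⟩
      2 ℕ.* chords α ℕ.+ 12 ℕ.* g            ∎)
      where
      open ℕ.≤-Reasoning
      identity : ∀ a b → 2 ℕ.* a ℕ.+ b ≡ b ℕ.+ a ℕ.+ a
      identity = solve-∀

  -- Passing from α to α⁻¹ζ costs half of 12g in the number of 2-cycles, and the bent points of α,
  -- counted twice, cost 24g; hence 30.
  reduced-chords≤ : chords α ℕ.≤ parallels α ℕ.+ (1 ℕ.+ 30 ℕ.* g)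
  reduced-chords≤ = ℕ.*-cancelˡ-≤ 2 (begin
    2 ℕ.* chords α
      ≡⟨ cong (chords α ℕ.+_) (ℕ.+-identityʳ (chords α)) ⟩
    chords α ℕ.+ chords α
      ≤⟨ chords+chords α ⟩
    n
      ≤⟨ β-n≤ ⟩
    2 ℕ.* chords β ℕ.+ 12 ℕ.* g
      ≤⟨ ℕ.+-monoˡ-≤ (12 ℕ.* g) (ℕ.*-monoʳ-≤ 2 (ℕ.≤-trans (chords-⁻¹ζ α)
           (ℕ.+-monoʳ-≤ (parallels α) (ℕ.+-monoʳ-≤ 1 (ℕ.+-mono-≤ bends≤ bends≤))))) ⟩
    2 ℕ.* (parallels α ℕ.+ (1 ℕ.+ (12 ℕ.* g ℕ.+ 12 ℕ.* g))) ℕ.+ 12 ℕ.* g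
      ≡⟨ identity (parallels α) g ⟩
    2 ℕ.* (parallels α ℕ.+ (1 ℕ.+ 30 ℕ.* g)) ∎)
    where
    open ℕ.≤-Reasoning
    identity : ∀ p g → 2 ℕ.* (p ℕ.+ (1 ℕ.+ (12 ℕ.* g ℕ.+ 12 ℕ.* g))) ℕ.+ 12 ℕ.* g ≡
                       2 ℕ.* (p ℕ.+ (1 ℕ.+ 30 ℕ.* g))
    identity = solve-∀

z-nonzero : (α : Permutation′ (suc n)) → ¬ z α ≡ 0
z-nonzero α z≡0 with () ← trans (sym (trans (z≡count α)
  (cong (ℕ._+ sum (λ i → ⟦ leastInCycle? α (suc i) ⟧))
    (⟦⟧-true (leastInCycle? α zero) (Least⇒leastInCycle α (λ _ → z≤n)))))) z≡0

¬reduced-2 : (α : Permutation′ 2) → ¬ IsReduced α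
¬reduced-2 α (¬fα , ¬fβ) with α ⟨$⟩ʳ zero in eq
... | zero     = ¬fα (zero , eq)
... | suc zero = ¬fβ (zero , ⁻¹ζ-≡ α zero zero eq)

¬genus-0 : ∀ {g} (α : Permutation′ 0) → ¬ HasGenus g α
¬genus-0 {suc g} α eq with () ← trans (ℕ.suc-injective eq) (ℕ.+-suc g (g ℕ.+ 0))

-- Double counting

length-─ : {P : Pred A 0ℓ} {xs : List A} (p : Any P xs) → suc (length (xs ─ p)) ≡ length xs
length-─ (here _)              = refl
length-─ {xs = _ ∷ _} (there p) = cong suc (length-─ p)

Any-─ : {P Q : Pred A 0ℓ} {xs : List A} (p : Any P xs) → (∀ {x} → P x → ¬ Q x) →
        Any Q xs → Any Q (xs ─ p)
Any-─ (here px) disj (here qx) = ⊥-elim (disj px qx)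
Any-─ (here px) disj (there q) = q
Any-─ (there p) disj (here qx) = here qx
Any-─ (there p) disj (there q) = there (Any-─ p disj q)

-- Each x deletes its own partner from ys, and by disjointness the partners of the later elements
-- survive.
length-≤ : (T : A → B → Set) (xs : List A) (ys : List B) →
           AllPairs (λ x x′ → ∀ y → T x y → ¬ T x′ y) xs → All (λ x → Any (T x) ys) xs →
           length xs ℕ.≤ length ys
length-≤ T []       ys _          _        = z≤n
length-≤ T (x ∷ xs) ys (x≉ ∷ xs≉) (p ∷ ps) = subst (suc (length xs) ℕ.≤_) (length-─ p)
  (s≤s (length-≤ T xs (ys ─ p) xs≉
    (All.zipWith (λ {x′} (disj , q) → Any-─ {P = T x} {T x′} p (disj _) q) (x≉ , ps))))

-- Permutations with a marked point

Marked : ℕ → Set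
Marked n = Permutation′ n × Fin n

module _ {P : Pred (Permutation′ n) 0ℓ} (P? : Decidable P)
         {M : Permutation′ n → Pred (Fin n) 0ℓ} (M? : ∀ α → Decidable (M α)) where

  private
    mark? : Decidable (λ ((α , x) : Marked n) → M α x)
    mark? (α , x) = M? α x

    list : List (Permutation′ n) → List (Marked n)
    list αs = filter mark? (cartesianProduct αs (allFin n))

  marked : List (Marked n)
  marked = list (filter P? (permutations n))

  marked-unique : AllPairs (λ (α₁ , x₁) (α₂ , x₂) → ¬ (α₁ ≈ α₂ × x₁ ≡ x₂)) marked
  marked-unique = Unique.filter⁺ (permutationSetoid n ×ₛ setoid (Fin n)) mark?
    (Unique.cartesianProduct⁺ (permutationSetoid n) (setoid (Fin n))
      (Unique.filter⁺ (permutationSetoid n) P? (permutations-unique n)) (Unique≡.allFin⁺ n))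

  marked⁻ : ∀ {α x} → (α , x) ∈ marked → P α × M α x
  marked⁻ {α} {x} p
    with p′ , m ← ∈-filter⁻ mark? {xs = cartesianProduct (filter P? (permutations n)) (allFin n)} p
    with α∈ , _ ← ∈-cartesianProduct⁻ (filter P? (permutations n)) (allFin n) p′ =
    proj₂ (∈-filter⁻ P? {xs = permutations n} α∈) , m

  -- The enumeration contains α only up to `≈`, so the conditions are required of every pointwise
  -- equal α′.
  marked⁺ : {R : Pred (Marked n) 0ℓ} (α : Permutation′ n) (x : Fin n) →
            (∀ {α′} → α ≈ α′ → P α′ × M α′ x × R (α′ , x)) → Any R marked
  marked⁺ α x f with α′ , α′∈ , α≈ ← find (permutations-complete α) with p , m , r ← f α≈ =
    lose (∈-filter⁺ mark? (∈-cartesianProduct⁺ (∈-filter⁺ P? α′∈ p) (∈-allFin x)) m) r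

  private
    length-list : ∀ (w : ℤ) αs → All (λ α → + 2 ℤ.* + count (M? α) ≡ w) αs →
                  + 2 ℤ.* + length (list αs) ≡ w ℤ.* + length αs
    length-list w []       []         = sym (ℤ.*-zeroʳ w)
    length-list w (α ∷ αs) (eq ∷ eqs) = begin
      + 2 ℤ.* + length (list (α ∷ αs))
        ≡⟨ cong (λ k → + 2 ℤ.* + k) lengths ⟩
      + 2 ℤ.* (+ count (M? α) ℤ.+ + length (list αs))
        ≡⟨ ℤ.*-distribˡ-+ (+ 2) (+ count (M? α)) (+ length (list αs)) ⟩
      + 2 ℤ.* + count (M? α) ℤ.+ + 2 ℤ.* + length (list αs)
        ≡⟨ cong₂ ℤ._+_ eq (length-list w αs eqs) ⟩
      w ℤ.+ w ℤ.* + length αs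
        ≡⟨ ℤ.*-suc w (+ length αs) ⟨
      w ℤ.* + suc (length αs) ∎
      where
      open ≡-Reasoning
      lengths : length (list (α ∷ αs)) ≡ count (M? α) ℕ.+ length (list αs)
      lengths = begin
        length (list (α ∷ αs))
          ≡⟨ cong length (filter-++ mark? (map (α ,_) (allFin n)) _) ⟩
        length (filter mark? (map (α ,_) (allFin n)) ++ list αs)
          ≡⟨ length-++ (filter mark? (map (α ,_) (allFin n))) ⟩
        length (filter mark? (map (α ,_) (allFin n))) ℕ.+ length (list αs)
          ≡⟨ cong (ℕ._+ length (list αs)) (trans (length-filter-map mark? (α ,_) (allFin n))
               (length-filter-tabulate (M? α) (λ i → i))) ⟩
        count (M? α) ℕ.+ length (list αs) ∎

  -- The factor 2 keeps the weights n - A and n - A - 2m free of halves.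
  length-marked : ∀ (w : ℤ) → (∀ α → P α → + 2 ℤ.* + count (M? α) ≡ w) →
                  + 2 ℤ.* + length marked ≡ w ℤ.* + length (filter P? (permutations n))
  length-marked w eq = length-list w (filter P? (permutations n))
    (All.map (λ {α} → eq α) (All.all-filter P? (permutations n)))

-- Reduced partitions with A and m fixed, and their recurrence

outside : Permutation′ n → ℕ
outside {n} α = n ℕ.∸ 2 ℕ.* chords α

-- The number of classes of parallel 2-cycles.
classes : Permutation′ n → ℕ
classes α = chords α ℕ.∸ parallels α

Kind : (g A m k : ℕ) → Permutation′ n → Set
Kind g A m k α = (IsReducedPartition g k α × outside α ≡ A) × classes α ≡ m

kind? : ∀ g A m k → Decidable (Kind {n} g A m k)
kind? g A m k α = (isReducedPartition? g k α ×-dec (_ ℕ.≟ _)) ×-dec (_ ℕ.≟ _)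

rKind : (g A m n k : ℕ) → ℕ
rKind g A m n k = length (filter (kind? g A m k) (permutations n))

doubling-respʳ : {α : Permutation′ (3 ℕ.+ n)} {x : Fin (3 ℕ.+ n)}
                 {α′ α″ : Permutation′ (suc n)} {c : Fin (suc n)} →
                 α′ ≈ α″ → Doubling α x α′ c → Doubling α x α″ c
doubling-respʳ {c = c} eq (doubling d c<d c↦d d↦c x≡c ext) =
  doubling d c<d (trans (sym (eq c)) c↦d) (trans (sym (eq d)) d↦c) x≡c record
    { E-map    = λ y → trans (E-map y) (cong E (eq y))
    ; low↦high = low↦high
    ; high↦low = high↦low
    ; low<high = low<high
    }
  where
  open Extends ext
  open Gap (suc c) (suc (inject₁ d))

doubling-respˡ : {α β : Permutation′ (3 ℕ.+ n)} {x : Fin (3 ℕ.+ n)}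
                 {α′ : Permutation′ (suc n)} {c : Fin (suc n)} →
                 α ≈ β → Doubling α x α′ c → Doubling β x α′ c
doubling-respˡ {c = c} eq (doubling d c<d c↦d d↦c x≡c ext) =
  doubling d c<d c↦d d↦c x≡c record
    { E-map    = λ y → trans (sym (eq _)) (E-map y)
    ; low↦high = trans (sym (eq _)) low↦high
    ; high↦low = trans (sym (eq _)) high↦low
    ; low<high = low<high
    }
  where open Extends ext

module _ {g A m k : ℕ} {α : Permutation′ (3 ℕ.+ n)} {x : Fin (3 ℕ.+ n)}
         {α′ : Permutation′ (suc n)} {c : Fin (suc n)} (D : Doubling α x α′ c) where

  private
    outside-≡ : outside α ≡ outside α′
    outside-≡ = trans (cong (λ c → 3 ℕ.+ n ℕ.∸ 2 ℕ.* c) (doubling-chords D))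
      (cong (3 ℕ.+ n ℕ.∸_) (ℕ.*-suc 2 (chords α′)))

    classes-≡ : classes α ≡ classes α′
    classes-≡ = cong₂ ℕ._∸_ (doubling-chords D) (doubling-parallels D)

  doubling-Kind⁺ : Kind g A m k α′ → Kind g A m (suc k) α
  doubling-Kind⁺ ((red , a) , b) =
    (doubling-reduced⁺ D {g} {k} red , trans outside-≡ a) , trans classes-≡ b

  doubling-Kind⁻ : Kind g A m (suc k) α → Kind g A m k α′
  doubling-Kind⁻ ((red , a) , b) =
    (doubling-reduced⁻ D {g} {k} red , trans (sym outside-≡) a) , trans (sym classes-≡) b

module _ (g A m n k : ℕ) where

  private
    D : Marked (3 ℕ.+ n) → Marked (suc n) → Set
    D (α , x) (α′ , c) = Doubling α x α′ c

    up : List (Marked (3 ℕ.+ n))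
    up = marked (kind? g A m (suc k)) parallel?

    down : List (Marked (suc n))
    down = marked (kind? g A m k) lowChord?

  marked-length : length up ≡ length down
  marked-length = ℕ.≤-antisym
    (length-≤ D up down
      (AllPairs.map (λ ≉ (α′ , _) d₁ d₂ → ≉
          (doubling-unique {α₁′ = α′} {α′} d₁ d₂ ((λ _ → refl) , refl)))
        (marked-unique (kind? g A m (suc k)) parallel?))
      (All.tabulate λ {(α , x)} p →
        let kind , par = marked⁻ (kind? g A m (suc k)) parallel? p
            α′ , c , d = contraction-exists α x (proj₁ (proj₁ (proj₁ (proj₁ kind)))) par
        in marked⁺ (kind? g A m k) lowChord? α′ c λ α′≈ →
          let d′ = doubling-respʳ α′≈ d in doubling-Kind⁻ {g = g} d′ kind , doubling-LowChord d′ , d′))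
    (length-≤ (λ y x → D x y) down up
      (AllPairs.map (λ ≉ (α , _) d₁ d₂ → ≉
          (contraction-unique {α₁ = α} {α} d₁ d₂ ((λ _ → refl) , refl)))
        (marked-unique (kind? g A m k) lowChord?))
      (All.tabulate λ {(α′ , c)} p →
        let kind , low = marked⁻ (kind? g A m k) lowChord? p
            α , x , d = doubling-exists α′ c low
        in marked⁺ (kind? g A m (suc k)) parallel? α x λ α≈ →
          let d′ = doubling-respˡ α≈ d in doubling-Kind⁺ {g = g} d′ kind , doubling-Parallel d′ , d′))

chords-weight : ∀ {g A m k} (α : Permutation′ n) → Kind g A m k α →
                + 2 ℤ.* + chords α ≡ + n ℤ.- + A
chords-weight {n} {A = A} α ((_ , a) , _) = begin
  + 2 ℤ.* + chords α                       ≡⟨ ℤ.pos-* 2 (chords α) ⟨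
  + (2 ℕ.* chords α)                       ≡⟨ identity (+ A) _ ⟩
  + A ℤ.+ + (2 ℕ.* chords α) ℤ.- + A       ≡⟨ cong (λ t → + t ℤ.- + A)
                                                (trans (cong (ℕ._+ 2 ℕ.* chords α) (sym a))
                                                (ℕ.m∸n+n≡m 2chords≤n)) ⟩
  + n ℤ.- + A                              ∎
  where
  open ≡-Reasoning
  identity : ∀ x y → y ≡ x ℤ.+ y ℤ.- x
  identity = ℤ.solve-∀
  2chords≤n : 2 ℕ.* chords α ℕ.≤ n
  2chords≤n = subst (ℕ._≤ n) (cong (chords α ℕ.+_) (sym (ℕ.+-identityʳ (chords α)))) (chords+chords α)

parallels-weight : ∀ {g A m k} (α : Permutation′ n) → Kind g A m k α →
                   + 2 ℤ.* + parallels α ≡ + n ℤ.- + A ℤ.- + 2 ℤ.* + m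
parallels-weight {n} {g} {A} {m} α kind@(_ , b) = begin
  + 2 ℤ.* + parallels α
    ≡⟨ identity (+ m) (+ parallels α) ⟩
  + 2 ℤ.* (+ m ℤ.+ + parallels α) ℤ.- + 2 ℤ.* + m
    ≡⟨ cong (λ t → + 2 ℤ.* + t ℤ.- + 2 ℤ.* + m)
         (trans (cong (ℕ._+ parallels α) (sym b)) (ℕ.m∸n+n≡m (parallels≤chords α))) ⟩
  + 2 ℤ.* + chords α ℤ.- + 2 ℤ.* + m
    ≡⟨ cong (ℤ._- + 2 ℤ.* + m) (chords-weight {g = g} α kind) ⟩
  + n ℤ.- + A ℤ.- + 2 ℤ.* + m ∎
  where
  open ≡-Reasoning
  identity : ∀ x y → + 2 ℤ.* y ≡ + 2 ℤ.* (x ℤ.+ y) ℤ.- + 2 ℤ.* x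
  identity = ℤ.solve-∀

¬Kind-0 : ∀ {g A m k} (α : Permutation′ 0) → ¬ Kind g A m k α
¬Kind-0 {g} α (((_ , _ , genus , _) , _) , _) = ¬genus-0 {g} α genus

¬Kind-2 : ∀ {g A m k} (α : Permutation′ 2) → ¬ Kind g A m k α
¬Kind-2 α (((red , _) , _) , _) = ¬reduced-2 α red

rKind≡0 : ∀ g A m n k → (∀ α → ¬ Kind {n} g A m k α) → rKind g A m n k ≡ 0
rKind≡0 g A m n k ¬kind =
  cong length (filter-none (kind? g A m k) (All.universal ¬kind (permutations n)))

-- Each side is twice the length of one of the matched lists: on n + 2 points a permutation carries
-- p marks with 2p = n + 2 - A - 2m, on n points K marks with 2K = n - A.
rKind-recurrence : ∀ g A m n k →
  (+ 2+ n ℤ.- + A ℤ.- + 2 ℤ.* + m) ℤ.* + rKind g A m (2+ n) (suc k) ≡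
  (+ n ℤ.- + A) ℤ.* + rKind g A m n k
-- `Doubling` starts from at least one point. For n = 0 both sides vanish: the genus equation would
-- read 1 = 2g on no points, and on two points α or α⁻¹ζ fixes the first.
rKind-recurrence g A m zero k
  rewrite rKind≡0 g A m 0 k (¬Kind-0 {g}) | rKind≡0 g A m 2 (suc k) (¬Kind-2 {g}) =
  trans (ℤ.*-zeroʳ (+ 2 ℤ.- + A ℤ.- + 2 ℤ.* + m)) (sym (ℤ.*-zeroʳ (+ 0 ℤ.- + A)))
rKind-recurrence g A m (suc n) k = begin
  (+ (3 ℕ.+ n) ℤ.- + A ℤ.- + 2 ℤ.* + m) ℤ.* + rKind g A m (3 ℕ.+ n) (suc k)
    ≡⟨ length-marked (kind? g A m (suc k)) parallel? _ (parallels-weight {g = g}) ⟨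
  + 2 ℤ.* + length (marked (kind? {n = 3 ℕ.+ n} g A m (suc k)) parallel?)
    ≡⟨ cong (λ l → + 2 ℤ.* + l) (marked-length g A m n k) ⟩
  + 2 ℤ.* + length (marked (kind? {n = suc n} g A m k) lowChord?)
    ≡⟨ length-marked (kind? g A m k) lowChord? _ (chords-weight {g = g}) ⟩
  (+ suc n ℤ.- + A) ℤ.* + rKind g A m (suc n) k ∎
  where open ≡-Reasoning

-- Multiplication by 1 - x²y

infixl 6 _⊕_

_⊕_ : Series → Series → Series
(F ⊕ G) n k = F n k ℤ.+ G n k

shift : Series → Series
shift F 0      k       = 0ℤ
shift F 1      k       = 0ℤ
shift F (2+ n) zero    = 0ℤ
shift F (2+ n) (suc k) = F n k

-- Multiplication by 1 - x²y on coefficients. Working with its iterates avoids associativity and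
-- commutativity of `⊛`.
δ : Series → Series
δ F n k = F n k ℤ.- shift F n k

δ^ : ℕ → Series → Series
δ^ zero    F = F
δ^ (suc N) F = δ (δ^ N F)

≋-sym : F ≋ G → G ≋ F
≋-sym p n k = sym (p n k)

≋-trans : {H : Series} → F ≋ G → G ≋ H → F ≋ H
≋-trans p q n k = trans (p n k) (q n k)

shift-cong : F ≋ G → shift F ≋ shift G
shift-cong p 0      k       = refl
shift-cong p 1      k       = refl
shift-cong p (2+ n) zero    = refl
shift-cong p (2+ n) (suc k) = p n k

δ-cong : F ≋ G → δ F ≋ δ G
δ-cong p n k = cong₂ ℤ._-_ (p n k) (shift-cong p n k)

δ^-cong : ∀ N → F ≋ G → δ^ N F ≋ δ^ N G
δ^-cong zero    p = p
δ^-cong (suc N) p = δ-cong (δ^-cong N p)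

δ^-δ : ∀ N F → δ^ N (δ F) ≡ δ (δ^ N F)
δ^-δ zero    F = refl
δ^-δ (suc N) F = cong δ (δ^-δ N F)

δ^-+ : ∀ M N F → δ^ (M ℕ.+ N) F ≡ δ^ M (δ^ N F)
δ^-+ zero    N F = refl
δ^-+ (suc M) N F = cong δ (δ^-+ M N F)

shift-⊕ : ∀ F G → shift (F ⊕ G) ≋ shift F ⊕ shift G
shift-⊕ F G 0      k       = refl
shift-⊕ F G 1      k       = refl
shift-⊕ F G (2+ n) zero    = refl
shift-⊕ F G (2+ n) (suc k) = refl

δ-⊕ : ∀ F G → δ (F ⊕ G) ≋ δ F ⊕ δ G
δ-⊕ F G n k = trans (cong (λ t → F n k ℤ.+ G n k ℤ.- t) (shift-⊕ F G n k))
  (identity (F n k) (G n k) (shift F n k) (shift G n k))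
  where
  identity : ∀ a b c d → a ℤ.+ b ℤ.- (c ℤ.+ d) ≡ (a ℤ.- c) ℤ.+ (b ℤ.- d)
  identity = ℤ.solve-∀

δ^-⊕ : ∀ N F G → δ^ N (F ⊕ G) ≋ δ^ N F ⊕ δ^ N G
δ^-⊕ zero    F G n k = refl
δ^-⊕ (suc N) F G = ≋-trans (δ-cong (δ^-⊕ N F G)) (δ-⊕ (δ^ N F) (δ^ N G))

sum-zero : ∀ n {t : Fin n → ℤ} → (∀ i → t i ≡ 0ℤ) → ∑[ i < n ] t i ≡ 0ℤ
sum-zero n t≡0 = trans (ℤΣ.sum-cong-≗ t≡0) (ℤΣ.sum-replicate-zero n)

module _ (H : ℕ → ℕ → ℤ) where

  -- H has the complementary index as a second argument, which turns a sum with truncated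
  -- subtraction into a sum over an antidiagonal.
  sum-drop-last : (∀ i → H i 0 ≡ 0ℤ) → ∀ n →
    ∑[ i ≤ suc n ] H (toℕ i) (suc n ℕ.∸ toℕ i) ≡ ∑[ i ≤ n ] H (toℕ i) (suc (n ℕ.∸ toℕ i))
  sum-drop-last H0 n = begin
    ∑[ i ≤ suc n ] t i
      ≡⟨ ℤΣ.sum-init-last t ⟩
    (∑[ i ≤ n ] t (inject₁ i)) ℤ.+ t (fromℕ (suc n))
      ≡⟨ cong₂ ℤ._+_ (ℤΣ.sum-cong-≗ init) last ⟩
    (∑[ i ≤ n ] H (toℕ i) (suc (n ℕ.∸ toℕ i))) ℤ.+ 0ℤ
      ≡⟨ ℤ.+-identityʳ _ ⟩
    ∑[ i ≤ n ] H (toℕ i) (suc (n ℕ.∸ toℕ i)) ∎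
    where
    open ≡-Reasoning
    t : Fin (2+ n) → ℤ
    t i = H (toℕ i) (suc n ℕ.∸ toℕ i)

    init : ∀ i → t (inject₁ i) ≡ H (toℕ i) (suc (n ℕ.∸ toℕ i))
    init i = cong₂ H (Fin.toℕ-inject₁ i)
      (trans (cong (suc n ℕ.∸_) (Fin.toℕ-inject₁ i)) (ℕ.+-∸-assoc 1 (Fin.toℕ≤pred[n] i)))

    last : t (fromℕ (suc n)) ≡ 0ℤ
    last = trans (cong (λ m → H m (suc n ℕ.∸ m)) (Fin.toℕ-fromℕ (suc n)))
      (trans (cong (H (suc n)) (ℕ.n∸n≡0 (suc n))) (H0 (suc n)))

  sum-last : (∀ i r → H i (suc r) ≡ 0ℤ) → ∀ n →
    ∑[ i ≤ n ] H (toℕ i) (n ℕ.∸ toℕ i) ≡ H n 0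
  sum-last H+ n = begin
    ∑[ i ≤ n ] t i
      ≡⟨ ℤΣ.sum-init-last t ⟩
    (∑[ i < n ] t (inject₁ i)) ℤ.+ t (fromℕ n)
      ≡⟨ cong₂ ℤ._+_ (sum-zero n init) last ⟩
    0ℤ ℤ.+ H n 0
      ≡⟨ ℤ.+-identityˡ (H n 0) ⟩
    H n 0 ∎
    where
    open ≡-Reasoning
    t : Fin (suc n) → ℤ
    t i = H (toℕ i) (n ℕ.∸ toℕ i)

    init : ∀ i → t (inject₁ i) ≡ 0ℤ
    init i = trans (cong (λ m → H m (n ℕ.∸ m)) (Fin.toℕ-inject₁ i))
      (trans (cong (H (toℕ i)) (ℕ.+-∸-assoc 1 (Fin.toℕ<n i))) (H+ (toℕ i) _))

    last : t (fromℕ n) ≡ H n 0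
    last = trans (cong (λ m → H m (n ℕ.∸ m)) (Fin.toℕ-fromℕ n)) (cong (H n) (ℕ.n∸n≡0 n))

⊛-congʳ : ∀ F {G G′} → G ≋ G′ → F ⊛ G ≋ F ⊛ G′
⊛-congʳ F p n k = ℤΣ.sum-cong-≗ λ (i : Fin (suc n)) → ℤΣ.sum-cong-≗ λ (j : Fin (suc k)) →
  cong (F (toℕ i) (toℕ j) ℤ.*_) (p (n ℕ.∸ toℕ i) (k ℕ.∸ toℕ j))

⊛-1ₛ : ∀ F → F ⊛ 1ₛ ≋ F
⊛-1ₛ F n k = begin
  (F ⊛ 1ₛ) n k
    ≡⟨ sum-last (λ i r → ∑[ j ≤ k ] (F i (toℕ j) ℤ.* 1ₛ r (k ℕ.∸ toℕ j)))
         (λ i r → sum-zero (suc k) λ j → ℤ.*-zeroʳ (F i (toℕ j))) n ⟩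
  ∑[ j ≤ k ] (F n (toℕ j) ℤ.* 1ₛ 0 (k ℕ.∸ toℕ j))
    ≡⟨ sum-last (λ j s → F n j ℤ.* 1ₛ 0 s) (λ j s → ℤ.*-zeroʳ (F n j)) k ⟩
  F n k ℤ.* 1ℤ
    ≡⟨ ℤ.*-identityʳ (F n k) ⟩
  F n k ∎
  where open ≡-Reasoning

shift-0 : ∀ F n → shift F n 0 ≡ 0ℤ
shift-0 F 0      = refl
shift-0 F 1      = refl
shift-0 F (2+ n) = refl

shift-≤1 : ∀ F {n} k → n ℕ.≤ 1 → shift F n k ≡ 0ℤ
shift-≤1 F k z≤n       = refl
shift-≤1 F k (s≤s z≤n) = refl

⊛-zero : ∀ F G n k → (∀ i j → G (n ℕ.∸ i) (k ℕ.∸ j) ≡ 0ℤ) → (F ⊛ G) n k ≡ 0ℤ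
⊛-zero F G n k G≡0 = sum-zero (suc n) λ i → sum-zero (suc k) λ j →
  trans (cong (F (toℕ i) (toℕ j) ℤ.*_) (G≡0 (toℕ i) (toℕ j))) (ℤ.*-zeroʳ (F (toℕ i) (toℕ j)))

⊛-shift : ∀ F G → F ⊛ shift G ≋ shift (F ⊛ G)
⊛-shift F G 0 k = ⊛-zero F (shift G) 0 k λ i j →
  shift-≤1 G (k ℕ.∸ j) (ℕ.≤-trans (ℕ.m∸n≤m 0 i) z≤n)
⊛-shift F G 1 k = ⊛-zero F (shift G) 1 k λ i j → shift-≤1 G (k ℕ.∸ j) (ℕ.m∸n≤m 1 i)
⊛-shift F G (2+ n) zero = ⊛-zero F (shift G) (2+ n) 0 λ i j →
  trans (cong (shift G (2+ n ℕ.∸ i)) (ℕ.0∸n≡0 j)) (shift-0 G (2+ n ℕ.∸ i))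
⊛-shift F G (2+ n) (suc k) = begin
  (F ⊛ shift G) (2+ n) (suc k)
    -- The factor x² makes the last two rows vanish, and y makes the last term of each remaining row
    -- vanish.
    ≡⟨ sum-drop-last row (λ i → row≤1 i 0 z≤n) (suc n) ⟩
  ∑[ i ≤ suc n ] row (toℕ i) (suc (suc n ℕ.∸ toℕ i))
    ≡⟨ sum-drop-last (λ i r → row i (suc r)) (λ i → row≤1 i 1 ℕ.≤-refl) n ⟩
  ∑[ i ≤ n ] row (toℕ i) (2+ (n ℕ.∸ toℕ i))
    ≡⟨ ℤΣ.sum-cong-≗ (λ (i : Fin (suc n)) →
         sum-drop-last (λ j s → F (toℕ i) j ℤ.* shift G (2+ (n ℕ.∸ toℕ i)) s)
           (λ j → ℤ.*-zeroʳ (F (toℕ i) j)) k) ⟩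
  (F ⊛ G) n k ∎
  where
  open ≡-Reasoning
  row : ℕ → ℕ → ℤ
  row i r = ∑[ j ≤ suc k ] (F i (toℕ j) ℤ.* shift G r (suc k ℕ.∸ toℕ j))

  row≤1 : ∀ i r → r ℕ.≤ 1 → row i r ≡ 0ℤ
  row≤1 i r r≤1 = sum-zero (2+ k) λ j →
    trans (cong (F i (toℕ j) ℤ.*_) (shift-≤1 G (suc k ℕ.∸ toℕ j) r≤1)) (ℤ.*-zeroʳ (F i (toℕ j)))

⊛-⊕ : ∀ F G H → F ⊛ (G ⊕ H) ≋ F ⊛ G ⊕ F ⊛ H
⊛-⊕ F G H n k = trans
  (ℤΣ.sum-cong-≗ λ (i : Fin (suc n)) → trans
    (ℤΣ.sum-cong-≗ λ (j : Fin (suc k)) → ℤ.*-distribˡ-+ (F (toℕ i) (toℕ j))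
      (G (n ℕ.∸ toℕ i) (k ℕ.∸ toℕ j)) (H (n ℕ.∸ toℕ i) (k ℕ.∸ toℕ j)))
    (ℤΣ.∑-distrib-+ (term G i) (term H i)))
  (ℤΣ.∑-distrib-+ (λ i → ∑[ j ≤ k ] term G i j) (λ i → ∑[ j ≤ k ] term H i j))
  where
  term : Series → Fin (suc n) → Fin (suc k) → ℤ
  term G i j = F (toℕ i) (toℕ j) ℤ.* G (n ℕ.∸ toℕ i) (k ℕ.∸ toℕ j)

⊛-δ : ∀ F G → F ⊛ δ G ≋ δ (F ⊛ G)
⊛-δ F G n k = begin
  (F ⊛ δ G) n k
    ≡⟨ identity₁ ((F ⊛ δ G) n k) ((F ⊛ shift G) n k) ⟩
  (F ⊛ δ G) n k ℤ.+ (F ⊛ shift G) n k ℤ.- (F ⊛ shift G) n k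
    ≡⟨ cong₂ ℤ._-_ (sym (⊛-⊕ F (δ G) (shift G) n k)) (⊛-shift F G n k) ⟩
  (F ⊛ (δ G ⊕ shift G)) n k ℤ.- shift (F ⊛ G) n k
    ≡⟨ cong (ℤ._- shift (F ⊛ G) n k) (⊛-congʳ F (λ n k → identity₂ (G n k) (shift G n k)) n k) ⟩
  δ (F ⊛ G) n k ∎
  where
  open ≡-Reasoning
  identity₁ : ∀ a b → a ≡ a ℤ.+ b ℤ.- b
  identity₁ = ℤ.solve-∀
  identity₂ : ∀ a b → a ℤ.- b ℤ.+ b ≡ a
  identity₂ = ℤ.solve-∀

⊛-δ^ : ∀ N F → F ⊛ δ^ N 1ₛ ≋ δ^ N F
⊛-δ^ zero    F = ⊛-1ₛ F
⊛-δ^ (suc N) F = ≋-trans (⊛-δ F (δ^ N 1ₛ)) (δ-cong (⊛-δ^ N F))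

1-x²y-⊛ : ∀ G → 1-x²y ⊛ G ≋ δ G
1-x²y-⊛ G n k = rows n
  where
  open ≡-Reasoning
  row : ℕ → ℕ → ℤ
  row i r = ∑[ j ≤ k ] (1-x²y i (toℕ j) ℤ.* G r (k ℕ.∸ toℕ j))

  row₀ : ∀ r → row 0 r ≡ G r k
  row₀ r = trans (cong₂ ℤ._+_ (ℤ.*-identityˡ (G r k)) (sum-zero k λ j → refl)) (ℤ.+-identityʳ (G r k))

  row₂ : ∀ k r → ∑[ j ≤ k ] (1-x²y 2 (toℕ j) ℤ.* G r (k ℕ.∸ toℕ j)) ≡ ℤ.- shift G (2+ r) k
  row₂ zero    r = refl
  row₂ (suc k) r = trans (cong (λ t → 0ℤ ℤ.+ (-1ℤ ℤ.* G r k ℤ.+ t)) (sum-zero k λ j → refl))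
    (trans (ℤ.+-identityˡ _) (trans (ℤ.+-identityʳ _) (ℤ.-1*i≡-i (G r k))))

  row-zero : ∀ i r → (∀ j → 1-x²y i j ≡ 0ℤ) → row i r ≡ 0ℤ
  row-zero i r P≡0 = sum-zero (suc k) λ j → cong (ℤ._* G r (k ℕ.∸ toℕ j)) (P≡0 (toℕ j))

  rows : ∀ n → ∑[ i ≤ n ] row (toℕ i) (n ℕ.∸ toℕ i) ≡ δ G n k
  rows 0 = cong (ℤ._+ 0ℤ) (row₀ 0)
  rows 1 = cong₂ ℤ._+_ (row₀ 1) (cong (ℤ._+ 0ℤ) (row-zero 1 0 λ _ → refl))
  rows (2+ n) = cong₂ ℤ._+_ (row₀ (2+ n)) (begin
    row 1 (suc n) ℤ.+ (row 2 n ℤ.+ ∑[ i < n ] row (3 ℕ.+ toℕ i) (2+ n ℕ.∸ (3 ℕ.+ toℕ i)))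
      ≡⟨ cong₂ (λ s t → s ℤ.+ (row 2 n ℤ.+ t)) (row-zero 1 (suc n) λ _ → refl)
           (sum-zero n λ i → row-zero (3 ℕ.+ toℕ i) (2+ n ℕ.∸ (3 ℕ.+ toℕ i)) λ _ → refl) ⟩
    0ℤ ℤ.+ (row 2 n ℤ.+ 0ℤ)
      ≡⟨ trans (ℤ.+-identityˡ _) (ℤ.+-identityʳ _) ⟩
    row 2 n
      ≡⟨ row₂ k n ⟩
    ℤ.- shift G (2+ n) k ∎)

1-x²y-^ : ∀ N → 1-x²y ^ₛ N ≋ δ^ N 1ₛ
1-x²y-^ zero    n k = refl
1-x²y-^ (suc N) = ≋-trans (1-x²y-⊛ (1-x²y ^ₛ N)) (δ-cong (1-x²y-^ N))

⊛-1-x²y-^ : ∀ N F → F ⊛ 1-x²y ^ₛ N ≋ δ^ N F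
⊛-1-x²y-^ N F = ≋-trans (⊛-congʳ F (1-x²y-^ N)) (⊛-δ^ N F)

-- Series that become polynomials after multiplication by a power of 1 - x²y

IsPolynomial-≋ : F ≋ G → IsPolynomial F → IsPolynomial G
IsPolynomial-≋ p (d , f) = d , λ n k d< → trans (sym (p n k)) (f n k d<)

IsPolynomial-⊕ : IsPolynomial F → IsPolynomial G → IsPolynomial (F ⊕ G)
IsPolynomial-⊕ (d , f) (e , g) = d ℕ.+ e , λ n k d+e< → cong₂ ℤ._+_
  (f n k (ℕ.≤-<-trans (ℕ.m≤m+n d e) d+e<)) (g n k (ℕ.≤-<-trans (ℕ.m≤n+m e d) d+e<))

IsPolynomial-δ : IsPolynomial F → IsPolynomial (δ F)
-- x²y has total degree 3.
IsPolynomial-δ {F} (d , f) = 3 ℕ.+ d , λ n k d< →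
  cong₂ ℤ._-_ (f n k (ℕ.≤-<-trans (ℕ.m≤n+m d 3) d<)) (vanish n k d<)
  where
  vanish : ∀ n k → 3 ℕ.+ d ℕ.< n ℕ.+ k → shift F n k ≡ 0ℤ
  vanish 0      k       d< = refl
  vanish 1      k       d< = refl
  vanish (2+ n) zero    d< = refl
  vanish (2+ n) (suc k) (s≤s (s≤s d<)) rewrite ℕ.+-suc n k = f n k (s≤s⁻¹ d<)

IsPolynomial-δ^ : ∀ N → IsPolynomial F → IsPolynomial (δ^ N F)
IsPolynomial-δ^ zero    p = p
IsPolynomial-δ^ (suc N) p = IsPolynomial-δ (IsPolynomial-δ^ N p)

IsPolynomial-1ₛ : IsPolynomial 1ₛ
IsPolynomial-1ₛ = 0 , λ { zero (suc k) _ → refl ; (suc n) k _ → refl }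

δ-Polynomial : Series → Set
δ-Polynomial F = ∃[ N ] IsPolynomial (δ^ N F)

δ-Polynomial-≋ : F ≋ G → δ-Polynomial F → δ-Polynomial G
δ-Polynomial-≋ p (N , f) = N , IsPolynomial-≋ (δ^-cong N p) f

δ-Polynomial-⊕ : δ-Polynomial F → δ-Polynomial G → δ-Polynomial (F ⊕ G)
δ-Polynomial-⊕ {F} {G} (M , f) (N , g) = M ℕ.+ N , IsPolynomial-≋ (≋-sym (δ^-⊕ (M ℕ.+ N) F G))
  (IsPolynomial-⊕
    (subst IsPolynomial (trans (sym (δ^-+ N M F)) (cong (λ L → δ^ L F) (ℕ.+-comm N M)))
      (IsPolynomial-δ^ N f))
    (subst IsPolynomial (sym (δ^-+ M N G)) (IsPolynomial-δ^ M g)))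

-- Solving the recurrence

-- The threshold N grows with each application of `δ`, whose recurrence is obtained by cancelling a
-- coefficient that is positive only for large n.
Recurrence : (A m N : ℕ) → Series → Set
Recurrence A m N F = ∀ n k → N ℕ.≤ n →
  (+ 2+ n ℤ.- + A ℤ.- + 2 ℤ.* + m) ℤ.* F (2+ n) (suc k) ≡ (+ n ℤ.- + A) ℤ.* F n k

cancel : ∀ t {x y w : ℤ} → w ≡ + suc t → w ℤ.* x ≡ w ℤ.* y → x ≡ y
cancel t {x} {y} refl = ℤ.*-cancelˡ-≡ (+ suc t) x y

cancel-0 : ∀ t {x w : ℤ} → w ≡ + suc t → w ℤ.* x ≡ 0ℤ → x ≡ 0ℤ
cancel-0 t {w = w} eq wx≡0 = cancel t eq (trans wx≡0 (sym (ℤ.*-zeroʳ w)))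

-- Both sides equal 2 m (e + 2 m) x₀.
recurrence-step : ∀ e m {x₀ x₁ x₂} →
  e ℤ.* x₁ ≡ (e ℤ.+ + 2 ℤ.* m) ℤ.* x₀ →
  (e ℤ.+ + 2) ℤ.* x₂ ≡ (e ℤ.+ + 2 ℤ.+ + 2 ℤ.* m) ℤ.* x₁ →
  e ℤ.* ((e ℤ.+ + 2) ℤ.* (x₂ ℤ.- x₁)) ≡ e ℤ.* ((e ℤ.+ + 2 ℤ.* m) ℤ.* (x₁ ℤ.- x₀))
recurrence-step e m {x₀} {x₁} {x₂} eq₁ eq₂ = begin
  e ℤ.* ((e ℤ.+ + 2) ℤ.* (x₂ ℤ.- x₁))
    ≡⟨ expand₁ e x₁ x₂ ⟩
  e ℤ.* ((e ℤ.+ + 2) ℤ.* x₂) ℤ.- (e ℤ.+ + 2) ℤ.* (e ℤ.* x₁)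
    ≡⟨ cong (λ y → e ℤ.* y ℤ.- (e ℤ.+ + 2) ℤ.* (e ℤ.* x₁)) eq₂ ⟩
  e ℤ.* ((e ℤ.+ + 2 ℤ.+ + 2 ℤ.* m) ℤ.* x₁) ℤ.- (e ℤ.+ + 2) ℤ.* (e ℤ.* x₁)
    ≡⟨ collect e m x₁ ⟩
  + 2 ℤ.* m ℤ.* (e ℤ.* x₁)
    ≡⟨ cong (+ 2 ℤ.* m ℤ.*_) eq₁ ⟩
  + 2 ℤ.* m ℤ.* ((e ℤ.+ + 2 ℤ.* m) ℤ.* x₀)
    ≡⟨ expand₂ e m x₀ ⟩
  (e ℤ.+ + 2 ℤ.* m) ℤ.* ((e ℤ.+ + 2 ℤ.* m) ℤ.* x₀ ℤ.- e ℤ.* x₀)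
    ≡⟨ cong (λ y → (e ℤ.+ + 2 ℤ.* m) ℤ.* (y ℤ.- e ℤ.* x₀)) eq₁ ⟨
  (e ℤ.+ + 2 ℤ.* m) ℤ.* (e ℤ.* x₁ ℤ.- e ℤ.* x₀)
    ≡⟨ expand₃ e (e ℤ.+ + 2 ℤ.* m) x₀ x₁ ⟩
  e ℤ.* ((e ℤ.+ + 2 ℤ.* m) ℤ.* (x₁ ℤ.- x₀)) ∎
  where
  open ≡-Reasoning
  expand₁ : ∀ e x y → e ℤ.* ((e ℤ.+ + 2) ℤ.* (y ℤ.- x)) ≡
                      e ℤ.* ((e ℤ.+ + 2) ℤ.* y) ℤ.- (e ℤ.+ + 2) ℤ.* (e ℤ.* x)
  expand₁ = ℤ.solve-∀
  collect : ∀ e m x → e ℤ.* ((e ℤ.+ + 2 ℤ.+ + 2 ℤ.* m) ℤ.* x) ℤ.- (e ℤ.+ + 2) ℤ.* (e ℤ.* x) ≡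
                      + 2 ℤ.* m ℤ.* (e ℤ.* x)
  collect = ℤ.solve-∀
  expand₂ : ∀ e m x → + 2 ℤ.* m ℤ.* ((e ℤ.+ + 2 ℤ.* m) ℤ.* x) ≡
                      (e ℤ.+ + 2 ℤ.* m) ℤ.* ((e ℤ.+ + 2 ℤ.* m) ℤ.* x ℤ.- e ℤ.* x)
  expand₂ = ℤ.solve-∀
  expand₃ : ∀ e u x y → u ℤ.* (e ℤ.* y ℤ.- e ℤ.* x) ≡ e ℤ.* (u ℤ.* (y ℤ.- x))
  expand₃ = ℤ.solve-∀

module _ {A m N : ℕ} (F≡0 : ∀ n → F n 0 ≡ 0ℤ) where

  private
    leading : ∀ {n} → A ℕ.+ 2 ℕ.* m ℕ.≤ n →
              ∃[ t ] (+ 2+ n ℤ.- + A ℤ.- + 2 ℤ.* + m ≡ + suc t)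
    leading {n} ≤n = suc (n ℕ.∸ (A ℕ.+ 2 ℕ.* m)) , (begin
      + 2+ n ℤ.- + A ℤ.- + 2 ℤ.* + m
        ≡⟨ cong (λ n → + 2+ n ℤ.- + A ℤ.- + 2 ℤ.* + m) (ℕ.m+[n∸m]≡n ≤n) ⟨
      + 2 ℤ.+ (+ A ℤ.+ + (2 ℕ.* m) ℤ.+ + s) ℤ.- + A ℤ.- + 2 ℤ.* + m
        ≡⟨ cong (λ t → + 2 ℤ.+ (+ A ℤ.+ t ℤ.+ + s) ℤ.- + A ℤ.- + 2 ℤ.* + m) (ℤ.pos-* 2 m) ⟩
      + 2 ℤ.+ (+ A ℤ.+ + 2 ℤ.* + m ℤ.+ + s) ℤ.- + A ℤ.- + 2 ℤ.* + m
        ≡⟨ identity (+ A) (+ m) (+ s) ⟩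
      + 2 ℤ.+ + s ∎)
      where
      open ≡-Reasoning
      s = n ℕ.∸ (A ℕ.+ 2 ℕ.* m)
      identity : ∀ a m s → + 2 ℤ.+ (a ℤ.+ + 2 ℤ.* m ℤ.+ s) ℤ.- a ℤ.- + 2 ℤ.* m ≡ + 2 ℤ.+ s
      identity = ℤ.solve-∀

  column-1 : Recurrence A m N F → ∀ n → N ℕ.≤ n → A ℕ.+ 2 ℕ.* m ℕ.≤ n → F (2+ n) 1 ≡ 0ℤ
  column-1 rec n N≤n A≤n with t , eq ← leading A≤n = cancel-0 t eq
    (trans (rec n 0 N≤n) (trans (cong ((+ n ℤ.- + A) ℤ.*_) (F≡0 n)) (ℤ.*-zeroʳ (+ n ℤ.- + A))))

  -- The model is Pascal's rule binomial(K-1, m-1) - binomial(K-2, m-1) = binomial(K-2, m-2) with K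
  -- = (n - A)/2: m drops by one and K by one, so A rises by two.
  Recurrence-δ : ∀ {m′} → m ≡ suc m′ → Recurrence A m N F →
                 Recurrence (2 ℕ.+ A) m′ (2 ℕ.+ (N ℕ.+ (A ℕ.+ 2 ℕ.* m))) (δ F)
  Recurrence-δ {m′} refl rec (2+ n) zero (s≤s (s≤s ≤n)) = begin
    -- At the start of a diagonal there is no third term for `recurrence-step`; beyond the threshold
    -- both entries vanish instead.
    w ℤ.* (F (4 ℕ.+ n) 1 ℤ.- F (2+ n) 0)
      ≡⟨ cong₂ (λ x y → w ℤ.* (x ℤ.- y))
           (column-1 rec (2+ n) (ℕ.≤-trans (ℕ.m≤m+n N _) ≤2+n) (ℕ.≤-trans (ℕ.m≤n+m _ N) ≤2+n))
           (F≡0 (2+ n)) ⟩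
    w ℤ.* 0ℤ
      ≡⟨ ℤ.*-zeroʳ w ⟩
    0ℤ
      ≡⟨ ℤ.*-zeroʳ u ⟨
    u ℤ.* 0ℤ
      ≡⟨ cong (λ x → u ℤ.* (x ℤ.- 0ℤ)) (F≡0 (2+ n)) ⟨
    u ℤ.* (F (2+ n) 0 ℤ.- 0ℤ) ∎
    where
    open ≡-Reasoning
    w u : ℤ
    w = + (4 ℕ.+ n) ℤ.- + (2 ℕ.+ A) ℤ.- + 2 ℤ.* + m′
    u = + (2+ n) ℤ.- + (2 ℕ.+ A)
    ≤2+n : N ℕ.+ (A ℕ.+ 2 ℕ.* m) ℕ.≤ 2+ n
    ≤2+n = ℕ.m≤n⇒m≤1+n (ℕ.m≤n⇒m≤1+n ≤n)
  Recurrence-δ {m′} refl rec (2+ n) (suc k) (s≤s (s≤s ≤n))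
    with t , eq ← leading (ℕ.≤-trans (ℕ.m≤n+m _ N) ≤n) =
    -- The cancelled factor e is the leading coefficient of the original recurrence at n.
    cancel t eq (begin
      e ℤ.* ((+ (4 ℕ.+ n) ℤ.- + (2 ℕ.+ A) ℤ.- + 2 ℤ.* + m′) ℤ.* δ F (4 ℕ.+ n) (2+ k))
        ≡⟨ cong (λ c → e ℤ.* (c ℤ.* δ F (4 ℕ.+ n) (2+ k))) (linear₁ (+ n) (+ A) (+ m′)) ⟩
      e ℤ.* ((e ℤ.+ + 2) ℤ.* δ F (4 ℕ.+ n) (2+ k))
        ≡⟨ recurrence-step e (+ m′)
             (trans (rec n k N≤n) (cong (ℤ._* F n k) (linear₂ (+ n) (+ A) (+ m′))))
             (trans (cong (ℤ._* F (4 ℕ.+ n) (2+ k)) (sym (linear₃ (+ n) (+ A) (+ m′))))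
               (trans (rec (2+ n) (suc k) (ℕ.m≤n⇒m≤1+n (ℕ.m≤n⇒m≤1+n N≤n)))
                 (cong (ℤ._* F (2+ n) (suc k)) (linear₄ (+ n) (+ A) (+ m′))))) ⟩
      e ℤ.* ((e ℤ.+ + 2 ℤ.* + m′) ℤ.* δ F (2+ n) (suc k))
        ≡⟨ cong (λ c → e ℤ.* (c ℤ.* δ F (2+ n) (suc k))) (linear₅ (+ n) (+ A) (+ m′)) ⟨
      e ℤ.* ((+ (2+ n) ℤ.- + (2 ℕ.+ A)) ℤ.* δ F (2+ n) (suc k)) ∎)
    where
    open ≡-Reasoning
    N≤n : N ℕ.≤ n
    N≤n = ℕ.≤-trans (ℕ.m≤m+n N _) ≤n

    e : ℤ
    e = + 2+ n ℤ.- + A ℤ.- + 2 ℤ.* + suc m′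

    linear₁ : ∀ n a m → + 4 ℤ.+ n ℤ.- (+ 2 ℤ.+ a) ℤ.- + 2 ℤ.* m ≡
                        + 2 ℤ.+ n ℤ.- a ℤ.- + 2 ℤ.* (+ 1 ℤ.+ m) ℤ.+ + 2
    linear₁ = ℤ.solve-∀
    linear₂ : ∀ n a m → n ℤ.- a ≡ + 2 ℤ.+ n ℤ.- a ℤ.- + 2 ℤ.* (+ 1 ℤ.+ m) ℤ.+ + 2 ℤ.* m
    linear₂ = ℤ.solve-∀
    linear₃ : ∀ n a m → + 4 ℤ.+ n ℤ.- a ℤ.- + 2 ℤ.* (+ 1 ℤ.+ m) ≡
                        + 2 ℤ.+ n ℤ.- a ℤ.- + 2 ℤ.* (+ 1 ℤ.+ m) ℤ.+ + 2
    linear₃ = ℤ.solve-∀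
    linear₄ : ∀ n a m → + 2 ℤ.+ n ℤ.- a ≡
                        + 2 ℤ.+ n ℤ.- a ℤ.- + 2 ℤ.* (+ 1 ℤ.+ m) ℤ.+ + 2 ℤ.+ + 2 ℤ.* m
    linear₄ = ℤ.solve-∀
    linear₅ : ∀ n a m → + 2 ℤ.+ n ℤ.- (+ 2 ℤ.+ a) ≡
                        + 2 ℤ.+ n ℤ.- a ℤ.- + 2 ℤ.* (+ 1 ℤ.+ m) ℤ.+ + 2 ℤ.* m
    linear₅ = ℤ.solve-∀

δ-column-0 : (∀ n → F n 0 ≡ 0ℤ) → ∀ n → δ F n 0 ≡ 0ℤ
δ-column-0 {F} F≡0 n rewrite shift-0 F n = trans (ℤ.+-identityʳ (F n 0)) (F≡0 n)

difference : ∀ {A n : ℕ} → A ℕ.< n → ∃[ t ] (+ n ℤ.- + A ≡ + suc t)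
difference {A} {n} A<n = n ℕ.∸ suc A , (begin
  + n ℤ.- + A                               ≡⟨ cong (λ n → + n ℤ.- + A) (ℕ.m+[n∸m]≡n A<n) ⟨
  + (suc A ℕ.+ (n ℕ.∸ suc A)) ℤ.- + A       ≡⟨ identity (+ A) (+ (n ℕ.∸ suc A)) ⟩
  + suc (n ℕ.∸ suc A)                       ∎)
  where
  open ≡-Reasoning
  identity : ∀ a s → + 1 ℤ.+ a ℤ.+ s ℤ.- a ≡ + 1 ℤ.+ s
  identity = ℤ.solve-∀

EventuallyZero : Series → Set
EventuallyZero F = ∃[ N ] (∀ n k → N ℕ.≤ n → F n k ≡ 0ℤ)

-- Once m has come down to 1, both coefficients equal n - A, so F is constant along diagonals for
-- large n and one more `δ` annihilates it there.
recurrence⇒eventuallyZero : ∀ m {A N} → Recurrence A (suc m) N F → (∀ n → F n 0 ≡ 0ℤ) →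
                            EventuallyZero (δ^ (suc m) F)
recurrence⇒eventuallyZero {F} zero {A} {N} rec F≡0 = 2+ (N ℕ.+ suc A) , vanish
  where
  vanish : ∀ n k → 2+ (N ℕ.+ suc A) ℕ.≤ n → δ F n k ≡ 0ℤ
  vanish n      zero    _ = δ-column-0 {F} F≡0 n
  vanish (2+ n) (suc k) (s≤s (s≤s ≤n))
    with t , eq ← difference (ℕ.≤-trans (ℕ.m≤n+m (suc A) N) ≤n) =
    ℤ.i≡j⇒i-j≡0 (cancel t eq (trans (cong (ℤ._* F (2+ n) (suc k)) (identity (+ n) (+ A)))
      (rec n k (ℕ.≤-trans (ℕ.m≤m+n N (suc A)) ≤n))))
    where
    identity : ∀ n a → n ℤ.- a ≡ + 2 ℤ.+ n ℤ.- a ℤ.- + 2 ℤ.* + 1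
    identity = ℤ.solve-∀
recurrence⇒eventuallyZero {F} (suc m) {A} {N} rec F≡0 =
  subst EventuallyZero (δ^-δ (suc m) F)
    (recurrence⇒eventuallyZero m {2+ A}
      (Recurrence-δ {F} {A} {suc (suc m)} {N} F≡0 refl rec) (δ-column-0 {F} F≡0))

-- The factor n - A kills the step from n = A to A + 2, while the left coefficient n + 2 - A stays
-- positive beyond A. The induction descends by two, hence the separate row n = 1.
recurrence⇒zero : ∀ {A} → Recurrence A 0 0 F → (∀ n → F n 0 ≡ 0ℤ) → (∀ k → F 1 k ≡ 0ℤ) →
                  (∀ n k → n ℕ.< A → F n k ≡ 0ℤ) → ∀ n k → A ℕ.< n → F n k ≡ 0ℤ
recurrence⇒zero rec col₀ row₁ small 1 k A<n = row₁ k
recurrence⇒zero rec col₀ row₁ small (2+ n) zero A<n = col₀ (2+ n)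
recurrence⇒zero {F} {A} rec col₀ row₁ small (2+ n) (suc k) A<n with t , eq ← difference A<n =
  cancel-0 t (trans (ℤ.+-identityʳ _) eq) (trans (rec n k z≤n) (vanish (ℕ.<-cmp n A)))
  where
  vanish : Tri (n ℕ.< A) (n ≡ A) (A ℕ.< n) → (+ n ℤ.- + A) ℤ.* F n k ≡ 0ℤ
  vanish (tri< n<A _ _) =
    trans (cong ((+ n ℤ.- + A) ℤ.*_) (small n k n<A)) (ℤ.*-zeroʳ (+ n ℤ.- + A))
  vanish (tri≈ _ refl _) = cong (ℤ._* F n k) (ℤ.+-inverseʳ (+ n))
  vanish (tri> _ _ A<n) = trans (cong ((+ n ℤ.- + A) ℤ.*_)
    (recurrence⇒zero rec col₀ row₁ small n k A<n)) (ℤ.*-zeroʳ (+ n ℤ.- + A))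

δ-upper : (∀ n k → n ℕ.< k → F n k ≡ 0ℤ) → ∀ n k → n ℕ.< k → δ F n k ≡ 0ℤ
δ-upper {F} upper n k n<k = cong₂ ℤ._-_ (upper n k n<k) (vanish n k n<k)
  where
  vanish : ∀ n k → n ℕ.< k → shift F n k ≡ 0ℤ
  vanish 0      k       _ = refl
  vanish 1      k       _ = refl
  vanish (2+ n) (suc k) (s≤s n<k) = upper n k (ℕ.<-trans (ℕ.n<1+n n) n<k)

δ^-upper : ∀ N → (∀ n k → n ℕ.< k → F n k ≡ 0ℤ) → ∀ n k → n ℕ.< k → δ^ N F n k ≡ 0ℤ
δ^-upper zero    upper = upper
δ^-upper (suc N) upper = δ-upper (δ^-upper N upper)

-- `EventuallyZero` bounds only the degree in x; the degree in y is bounded because there are at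
-- most as many parts as points.
eventuallyZero⇒polynomial : EventuallyZero F → (∀ n k → n ℕ.< k → F n k ≡ 0ℤ) → IsPolynomial F
eventuallyZero⇒polynomial {F} (N , f) upper = N ℕ.+ N , vanish
  where
  vanish : ∀ n k → N ℕ.+ N ℕ.< n ℕ.+ k → F n k ≡ 0ℤ
  vanish n k 2N< with N ℕ.≤? n | n ℕ.<? k
  ... | yes N≤n | _       = f n k N≤n
  ... | no  _   | yes n<k = upper n k n<k
  ... | no  N≰n | no n≮k  = contradiction 2N< (ℕ.≤⇒≯ (ℕ.+-mono-≤ n≤N (ℕ.≤-trans (ℕ.≮⇒≥ n≮k) n≤N)))
    where n≤N = ℕ.<⇒≤ (ℕ.≰⇒> N≰n)

-- The generating function as a sum over the kinds

kindSeries : (g A m : ℕ) → Series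
kindSeries g A m n k = + rKind g A m n k

δ-Polynomial-kindSeries : ∀ g A m → δ-Polynomial (kindSeries g A m)
δ-Polynomial-kindSeries g A m = m , polynomial m refl
  where
  zero-if : ∀ n k → (∀ α → ¬ Kind {n} g A m k α) → kindSeries g A m n k ≡ 0ℤ
  zero-if n k ¬kind = cong +_ (rKind≡0 g A m n k ¬kind)

  column₀ : ∀ n → kindSeries g A m n 0 ≡ 0ℤ
  column₀ zero    = zero-if 0 0 (¬Kind-0 {g})
  column₀ (suc n) = zero-if (suc n) 0 λ α (((_ , _ , _ , z≡0) , _) , _) → z-nonzero α z≡0

  row₁ : ∀ k → kindSeries g A m 1 k ≡ 0ℤ
  row₁ k = zero-if 1 k λ α ((((¬fα , _) , _) , _) , _) → ¬fα (zero , fixed _)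
    where
    fixed : (x : Fin 1) → x ≡ zero
    fixed zero = refl

  small : ∀ n k → n ℕ.< A → kindSeries g A m n k ≡ 0ℤ
  small n k n<A = zero-if n k λ α ((_ , eq) , _) →
    ℕ.<⇒≱ n<A (subst (ℕ._≤ n) eq (ℕ.m∸n≤m n (2 ℕ.* chords α)))

  upper : ∀ n k → n ℕ.< k → kindSeries g A m n k ≡ 0ℤ
  upper n k n<k = zero-if n k λ α (((_ , _ , _ , z≡k) , _) , _) →
    ℕ.<⇒≱ n<k (subst (ℕ._≤ n) z≡k (z≤size α))

  recurrence : Recurrence A m 0 (kindSeries g A m)
  recurrence n k _ = rKind-recurrence g A m n k

  polynomial : ∀ m′ → m′ ≡ m → IsPolynomial (δ^ m′ (kindSeries g A m))
  polynomial zero refl = eventuallyZero⇒polynomial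
    (suc A , recurrence⇒zero {kindSeries g A 0} {A} recurrence column₀ row₁ small) upper
  polynomial (suc m′) refl = eventuallyZero⇒polynomial
    (recurrence⇒eventuallyZero {kindSeries g A m} m′ {A} {0} recurrence column₀)
    (δ^-upper {kindSeries g A m} (suc m′) upper)

-- Splitting a count by a bounded statistic

module _ {P : Pred A 0ℓ} (P? : Decidable P) where

  length-filter-∷ : ∀ x xs → length (filter P? (x ∷ xs)) ≡ ⟦ P? x ⟧ ℕ.+ length (filter P? xs)
  length-filter-∷ x xs with does (P? x)
  ... | true  = refl
  ... | false = refl

module _ {P Q : Pred A 0ℓ} (P? : Decidable P) (Q? : Decidable Q) where

  length-filter-cong : (∀ x → P x → Q x) → (∀ x → Q x → P x) →
    ∀ xs → length (filter P? xs) ≡ length (filter Q? xs)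
  length-filter-cong f g []       = refl
  length-filter-cong f g (x ∷ xs) = trans (length-filter-∷ P? x xs)
    (trans (cong₂ ℕ._+_ (⟦⟧-cong (P? x) (Q? x) (f x) (g x)) (length-filter-cong f g xs))
      (sym (length-filter-∷ Q? x xs)))

module _ {P : Pred A 0ℓ} (P? : Decidable P) (s : A → ℕ) where

  upTo? : ∀ b → Decidable (λ x → P x × s x ℕ.≤ b)
  upTo? b x = P? x ×-dec (s x ℕ.≤? b)

  at? : ∀ b → Decidable (λ x → P x × s x ≡ b)
  at? b x = P? x ×-dec (s x ℕ.≟ b)

  ⟦⟧-upTo-suc : ∀ b x → ⟦ upTo? (suc b) x ⟧ ≡ ⟦ upTo? b x ⟧ ℕ.+ ⟦ at? (suc b) x ⟧
  ⟦⟧-upTo-suc b x with P? x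
  ... | no _  = refl
  ... | yes _ with ℕ.<-cmp (s x) (suc b)
  ...   | tri< lt ne _ = trans (⟦⟧-true (s x ℕ.≤? suc b) (ℕ.<⇒≤ lt))
    (sym (cong₂ ℕ._+_ (⟦⟧-true (s x ℕ.≤? b) (s≤s⁻¹ lt)) (⟦⟧-false (s x ℕ.≟ suc b) ne)))
  ...   | tri≈ _ eq _ = trans (⟦⟧-true (s x ℕ.≤? suc b) (ℕ.≤-reflexive eq))
    (sym (cong₂ ℕ._+_ (⟦⟧-false (s x ℕ.≤? b) (ℕ.<⇒≱ (ℕ.≤-reflexive (sym eq))))
      (⟦⟧-true (s x ℕ.≟ suc b) eq)))
  ...   | tri> _ ne gt = trans (⟦⟧-false (s x ℕ.≤? suc b) (ℕ.<⇒≱ gt))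
    (sym (cong₂ ℕ._+_ (⟦⟧-false (s x ℕ.≤? b) (ℕ.<⇒≱ (ℕ.<-trans (ℕ.n<1+n b) gt)))
      (⟦⟧-false (s x ℕ.≟ suc b) ne)))

  length-upTo-suc : ∀ b xs → length (filter (upTo? (suc b)) xs) ≡
    length (filter (upTo? b) xs) ℕ.+ length (filter (at? (suc b)) xs)
  length-upTo-suc b []       = refl
  length-upTo-suc b (x ∷ xs) = begin
    length (filter (upTo? (suc b)) (x ∷ xs))
      ≡⟨ length-filter-∷ (upTo? (suc b)) x xs ⟩
    ⟦ upTo? (suc b) x ⟧ ℕ.+ length (filter (upTo? (suc b)) xs)
      ≡⟨ cong₂ ℕ._+_ (⟦⟧-upTo-suc b x) (length-upTo-suc b xs) ⟩
    _
      ≡⟨ interchange ⟦ upTo? b x ⟧ ⟦ at? (suc b) x ⟧ (length (filter (upTo? b) xs)) _ ⟩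
    (⟦ upTo? b x ⟧ ℕ.+ length (filter (upTo? b) xs)) ℕ.+
    (⟦ at? (suc b) x ⟧ ℕ.+ length (filter (at? (suc b)) xs))
      ≡⟨ cong₂ ℕ._+_ (length-filter-∷ (upTo? b) x xs) (length-filter-∷ (at? (suc b)) x xs) ⟨
    length (filter (upTo? b) (x ∷ xs)) ℕ.+ length (filter (at? (suc b)) (x ∷ xs)) ∎
    where
    open ≡-Reasoning
    interchange : ∀ a b c d → a ℕ.+ b ℕ.+ (c ℕ.+ d) ≡ (a ℕ.+ c) ℕ.+ (b ℕ.+ d)
    interchange = solve-∀

module _ {P : ∀ {n} → ℕ → Pred (Permutation′ n) 0ℓ} (P? : ∀ {n} k → Decidable (P {n} k)) where

  counting : Series
  counting n k = + length (filter (P? k) (permutations n))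

module _ {P : ∀ {n} → ℕ → Pred (Permutation′ n) 0ℓ} (P? : ∀ {n} k → Decidable (P {n} k))
         (s : ∀ {n} → Permutation′ n → ℕ)
         (good : ∀ a → δ-Polynomial (counting (λ k → at? (P? k) s a))) where

  private
    upTo at : ℕ → Series
    upTo b = counting (λ k → upTo? (P? k) s b)
    at b   = counting (λ k → at? (P? k) s b)

    δ-Polynomial-upTo : ∀ b → δ-Polynomial (upTo b)
    δ-Polynomial-upTo zero = δ-Polynomial-≋ {at 0} {upTo 0} (λ n k → cong +_
      (length-filter-cong (at? (P? k) s 0) (upTo? (P? k) s 0)
        (λ { _ (p , eq) → p , ℕ.≤-reflexive eq }) (λ { _ (p , le) → p , ℕ.n≤0⇒n≡0 le })
        (permutations n))) (good 0)
    δ-Polynomial-upTo (suc b) = δ-Polynomial-≋ {upTo b ⊕ at (suc b)} {upTo (suc b)}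
      (λ n k → cong +_ (sym (length-upTo-suc (P? k) s b (permutations n))))
      (δ-Polynomial-⊕ {upTo b} {at (suc b)} (δ-Polynomial-upTo b) (good (suc b)))

  -- The bound b is uniform in n and k, so the series is a finite sum. The lemma is applied to
  -- `outside` and, for each of its values, to `classes`.
  δ-Polynomial-counting : ∀ b → (∀ {n} k (α : Permutation′ n) → P k α → s α ℕ.≤ b) →
                          δ-Polynomial (counting P?)
  δ-Polynomial-counting b s≤b = δ-Polynomial-≋ {upTo b} {counting P?} (λ n k → cong +_
    (length-filter-cong (upTo? (P? k) s b) (P? k) (λ _ → proj₁) (λ α p → p , s≤b k α p)
      (permutations n))) (δ-Polynomial-upTo b)

δ-Polynomial-R : ∀ g → δ-Polynomial (R g)
δ-Polynomial-R g = δ-Polynomial-≋ {counting reduced?} {R g} ≋R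
  (δ-Polynomial-counting {Reduced} reduced? outside
    (λ A → δ-Polynomial-counting {λ k α → Reduced k α × outside α ≡ A}
      (λ k → at? (reduced? k) outside A)
      classes (δ-Polynomial-kindSeries′ A) (1 ℕ.+ 30 ℕ.* g)
      (λ k α (red , _) → ℕ.m≤n+o⇒m∸n≤o (chords α) (parallels α)
        (reduced-chords≤ {g = g} {k} {α} red)))
    (12 ℕ.* g) (λ {n} k α red → ℕ.m≤n+o⇒m∸n≤o n (2 ℕ.* chords α) (reduced-n≤ {g = g} {k} {α} red)))
  where
  Reduced : ∀ {n} → ℕ → Pred (Permutation′ n) 0ℓ
  Reduced k = IsReducedPartition g k

  reduced? : ∀ {n} k → Decidable (Reduced {n} k)
  reduced? = isReducedPartition? g

  δ-Polynomial-kindSeries′ : ∀ A m →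
    δ-Polynomial (counting (λ k → at? (at? (reduced? k) outside A) classes m))
  δ-Polynomial-kindSeries′ A m = δ-Polynomial-≋ {kindSeries g A m} (λ n k → cong +_
    (length-filter-cong (kind? g A m k) (at? (at? (reduced? k) outside A) classes m)
      (λ _ p → p) (λ _ p → p) (permutations n))) (δ-Polynomial-kindSeries g A m)

  none : ∀ n k → (∀ α → ¬ Reduced {n} k α) → counting reduced? n k ≡ 0ℤ
  none n k ¬red = cong (λ αs → + length αs)
    (filter-none (reduced? k) (All.universal ¬red (permutations n)))

  ≋R : counting reduced? ≋ R g
  ≋R zero    k       = none 0 k λ α (_ , _ , genus , _) → ¬genus-0 {g} α genus
  ≋R (suc n) zero    = none (suc n) 0 λ α (_ , _ , _ , z≡0) → z-nonzero α z≡0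
  ≋R (suc n) (suc k) = refl

δ-Polynomial⇒rational : ∀ F → δ-Polynomial F → IsRational F × DenominatorIsPowerOf 1-x²y F
δ-Polynomial⇒rational F (N , poly) =
  (δ^ N F , 1-x²y ^ₛ N , poly ,
    IsPolynomial-≋ {δ^ N 1ₛ} {1-x²y ^ₛ N} (≋-sym (1-x²y-^ N)) (IsPolynomial-δ^ N IsPolynomial-1ₛ) ,
    -- The denominator is nonzero because its constant coefficient is 1.
    (λ Q≋0 → case trans (sym (constant N)) (trans (sym (1-x²y-^ N 0 0)) (Q≋0 0 0)) of λ ()) ,
    ⊛-1-x²y-^ N F) ,
  (δ^ N F , N , poly , ⊛-1-x²y-^ N F)
  where
  constant : ∀ N → δ^ N 1ₛ 0 0 ≡ 1ℤ
  constant zero    = refl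
  constant (suc N) = trans (ℤ.+-identityʳ (δ^ N 1ₛ 0 0)) (constant N)

corollary6p9 : (g : ℕ) → IsRational (R g) × DenominatorIsPowerOf 1-x²y (R g)
corollary6p9 g = δ-Polynomial⇒rational (R g) (δ-Polynomial-R g)
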